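{- Let $G_1, G_2$ be disjoint graphs, where $G_i$ has $n_i$ vertices and $m_i$ edges with $m_i \ge n_i$ for $i = 1,2$, such that $2$ is not a signless Laplacian eigenvalue of either $G_1$ or $G_2$. Let $u$ be a vertex of $G_1$ and $v$ a vertex of $G_2$. If $\varphi_{G_1}(u) + \varphi_{G_2}(v) > -1$, then the graph $G = G_1 \cup G_2 + uv$, obtained from the disjoint union of $G_1$ and $G_2$ by adding the edge $uv$, satisfies $$s(L(G)) = s(L(G_1)) + s(L(G_2)) - 1,$$ and $2$ is not a signless Laplacian eigenvalue of $G$.
   Context: All graphs are finite and simple. For a graph $H$ with adjacency matrix $A(H)$, the signature $s(H)$ is the number of positive eigenvalues of $A(H)$ minus the number of negative eigenvalues of $A(H)$, counted with multiplicity. The line graph $L(G)$ has the edges of $G$ as vertices, two being adjacent when they are distinct and share an endpoint. The signless Laplacian of $G$ is $Q(G) = A(G) + D(G)$, where $D(G)$ is the diagonal matrix of vertex degrees; its eigenvalues are the signless Laplacian eigenvalues of $G$. For a graph $G$ such that $2$ is not an eigenvalue of $Q(G)$, and a vertex $x$ of $G$, $\varphi_G(x)$ denotes the $(x,x)$ entry of $(Q(G) - 2I)^{ -1}$. -}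

module Defs where

open import Level using (Level; 0ℓ; _⊔_) renaming (suc to lsuc)
open import Algebra.Bundles using (CommutativeRing)
open import Algebra.Core using (Op₁; Op₂)
open import Algebra.Structures using (IsCommutativeRing)
import Algebra.Definitions.RawMonoid as RawMonoidDefinitions
import Algebra.Properties.Semiring.Sum as SemiringSum
open import Data.Fin.Base using (Fin; splitAt) renaming (_<_ to _<ᶠ_)
open import Data.Fin.Properties using () renaming (_≟_ to _≟ᶠ_; _<?_ to _<ᶠ?_)
open import Data.Integer.Base using (ℤ; _⊖_)
open import Data.List.Base using (List; allFin; cartesianProduct; filter; length; lookup)
open import Data.Nat.Base using (ℕ) renaming (_+_ to _+ⁿ_)
open import Data.Product.Base using (_×_; _,_; ∃-syntax; swap)
open import Data.Sum.Base using (_⊎_; inj₁; inj₂)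
open import Data.Vec.Functional using (Vector)
open import Relation.Binary.Core using (Rel)
open import Relation.Binary.Definitions using (Decidable; Irreflexive; Symmetric)
open import Relation.Binary.PropositionalEquality.Core as ≡ using (_≡_; _≢_)
open import Relation.Binary.Structures using (IsStrictTotalOrder)
open import Relation.Nullary.Decidable using (does; ¬?; _×-dec_; _⊎-dec_)
open import Relation.Nullary.Negation using (¬_)
open import Relation.Unary using (Pred) renaming (Decidable to Decidable₁)
open import Data.Bool.Base using (if_then_else_)

private
  variable
    p : Level
    n n₁ n₂ : ℕ

count : {P : Pred (Fin n) p} → Decidable₁ P → ℕ
count {n = n} P? = length (filter P? (allFin n))

------------------------------------------------------------------------
-- Finite simple graphs

record Graph (n : ℕ) : Set₁ where
  field
    Adj    : Rel (Fin n) 0ℓ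
    adj?   : Decidable Adj
    sym    : Symmetric Adj
    irrefl : Irreflexive _≡_ Adj

open Graph

degree : Graph n → Fin n → ℕ
degree G x = count (adj? G x)

-- Each edge {x , y} is listed exactly once, as the pair with x < y.
edges : Graph n → List (Fin n × Fin n)
edges {n} G =
  filter (λ (x , y) → (x <ᶠ? y) ×-dec adj? G x y)
         (cartesianProduct (allFin n) (allFin n))

size : Graph n → ℕ
size G = length (edges G)

ShareEndpoint : Rel (Fin n × Fin n) 0ℓ
ShareEndpoint (a , b) (c , d) = (a ≡ c ⊎ a ≡ d) ⊎ (b ≡ c ⊎ b ≡ d)

shareEndpoint? : Decidable (ShareEndpoint {n})
shareEndpoint? (a , b) (c , d) =
  ((a ≟ᶠ c) ⊎-dec (a ≟ᶠ d)) ⊎-dec ((b ≟ᶠ c) ⊎-dec (b ≟ᶠ d))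

shareEndpoint-sym : Symmetric (ShareEndpoint {n})
shareEndpoint-sym (inj₁ (inj₁ e)) = inj₁ (inj₁ (≡.sym e))
shareEndpoint-sym (inj₁ (inj₂ e)) = inj₂ (inj₁ (≡.sym e))
shareEndpoint-sym (inj₂ (inj₁ e)) = inj₁ (inj₂ (≡.sym e))
shareEndpoint-sym (inj₂ (inj₂ e)) = inj₂ (inj₂ (≡.sym e))

-- The vertices are positions in the list of edges; as that list has no
-- repetitions, distinct positions are distinct edges.
lineGraph : (G : Graph n) → Graph (size G)
lineGraph G = record
  { Adj    = λ e f → e ≢ f × ShareEndpoint (edge e) (edge f)
  ; adj?   = λ e f → ¬? (e ≟ᶠ f) ×-dec shareEndpoint? (edge e) (edge f)
  ; sym    = λ (e≢f , s) → ≡.≢-sym e≢f , shareEndpoint-sym s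
  ; irrefl = λ e≡f (e≢f , _) → e≢f e≡f
  }
  where
  edge : Fin (size G) → _
  edge = lookup (edges G)

module _ (G₁ : Graph n₁) (G₂ : Graph n₂) (u : Fin n₁) (v : Fin n₂) where

  private
    JoinAdj : Rel (Fin n₁ ⊎ Fin n₂) 0ℓ
    JoinAdj (inj₁ x) (inj₁ y) = Adj G₁ x y
    JoinAdj (inj₂ x) (inj₂ y) = Adj G₂ x y
    JoinAdj (inj₁ x) (inj₂ y) = x ≡ u × y ≡ v
    JoinAdj (inj₂ x) (inj₁ y) = x ≡ v × y ≡ u

    joinAdj? : Decidable JoinAdj
    joinAdj? (inj₁ x) (inj₁ y) = adj? G₁ x y
    joinAdj? (inj₂ x) (inj₂ y) = adj? G₂ x y
    joinAdj? (inj₁ x) (inj₂ y) = (x ≟ᶠ u) ×-dec (y ≟ᶠ v)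
    joinAdj? (inj₂ x) (inj₁ y) = (x ≟ᶠ v) ×-dec (y ≟ᶠ u)

    joinAdj-sym : Symmetric JoinAdj
    joinAdj-sym {inj₁ _} {inj₁ _} = sym G₁
    joinAdj-sym {inj₂ _} {inj₂ _} = sym G₂
    joinAdj-sym {inj₁ _} {inj₂ _} = swap
    joinAdj-sym {inj₂ _} {inj₁ _} = swap

    joinAdj-irrefl : ∀ x → ¬ JoinAdj x x
    joinAdj-irrefl (inj₁ _) = irrefl G₁ ≡.refl
    joinAdj-irrefl (inj₂ _) = irrefl G₂ ≡.refl

  -- The disjoint union of G₁ and G₂ together with the edge uv.
  joinByEdge : Graph (n₁ +ⁿ n₂)
  joinByEdge = record
    { Adj    = λ x y → JoinAdj (splitAt n₁ x) (splitAt n₁ y)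
    ; adj?   = λ x y → joinAdj? (splitAt n₁ x) (splitAt n₁ y)
    ; sym    = λ {x} {y} → joinAdj-sym {splitAt n₁ x} {splitAt n₁ y}
    ; irrefl = λ { {x} ≡.refl → joinAdj-irrefl (splitAt n₁ x) }
    }

------------------------------------------------------------------------
-- Ordered fields

-- The real numbers of classical mathematics are the intended instance;
-- none of the notions below refers to anything beyond this structure.
record OrderedField c ℓ₁ ℓ₂ : Set (lsuc (c ⊔ ℓ₁ ⊔ ℓ₂)) where
  infix  8 -_
  infixl 7 _*_
  infixl 6 _+_
  infix  4 _≈_ _<_
  field
    Carrier            : Set c
    _≈_                : Rel Carrier ℓ₁
    _<_                : Rel Carrier ℓ₂
    _+_                : Op₂ Carrier
    _*_                : Op₂ Carrier
    -_                 : Op₁ Carrier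
    0#                 : Carrier
    1#                 : Carrier
    isCommutativeRing  : IsCommutativeRing _≈_ _+_ _*_ -_ 0# 1#
    0≉1                : ¬ (0# ≈ 1#)
    inverse            : ∀ x → ¬ (x ≈ 0#) → ∃[ y ] x * y ≈ 1#
    isStrictTotalOrder : IsStrictTotalOrder _≈_ _<_
    +-monoˡ-<          : ∀ z {x y} → x < y → x + z < y + z
    *-pos              : ∀ {x y} → 0# < x → 0# < y → 0# < x * y

  commutativeRing : CommutativeRing c ℓ₁
  commutativeRing = record { isCommutativeRing = isCommutativeRing }

  open CommutativeRing commutativeRing public
    using (_-_; semiring; +-rawMonoid)

  open IsStrictTotalOrder isStrictTotalOrder public
    using (compare; _≟_; _<?_)

------------------------------------------------------------------------
-- Spectra

module Spectral {c ℓ₁ ℓ₂} (F : OrderedField c ℓ₁ ℓ₂) where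

  open OrderedField F public
  open SemiringSum semiring using (sum)
  open RawMonoidDefinitions +-rawMonoid using () renaming (_×_ to _×#_)

  2# : Carrier
  2# = 1# + 1#

  Matrix : ℕ → Set c
  Matrix n = Fin n → Fin n → Carrier

  infixl 7 _·_ _·ᵛ_
  infixl 6 _−ᴹ_
  infix  4 _≈ᵛ_ _≈ᴹ_

  _≈ᵛ_ : Rel (Vector Carrier n) ℓ₁
  x ≈ᵛ y = ∀ i → x i ≈ y i

  _≈ᴹ_ : Rel (Matrix n) ℓ₁
  M ≈ᴹ N = ∀ i j → M i j ≈ N i j

  _·ᵛ_ : Matrix n → Vector Carrier n → Vector Carrier n
  (M ·ᵛ x) i = sum (λ j → M i j * x j)

  _·_ : Op₂ (Matrix n)
  (M · N) i k = sum (λ j → M i j * N j k)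

  _−ᴹ_ : Op₂ (Matrix n)
  (M −ᴹ N) i j = M i j - N i j

  diagonal : Vector Carrier n → Matrix n
  diagonal d i j = if does (i ≟ᶠ j) then d i else 0#

  scalar : Carrier → Matrix n
  scalar a = diagonal (λ _ → a)

  record Inverse (M : Matrix n) : Set (c ⊔ ℓ₁) where
    field
      matrix   : Matrix n
      inverseˡ : matrix · M ≈ᴹ scalar 1#
      inverseʳ : M · matrix ≈ᴹ scalar 1#

  Eigenspace : Matrix n → Carrier → Pred (Vector Carrier n) ℓ₁
  Eigenspace M a x = M ·ᵛ x ≈ᵛ (λ i → a * x i)

  IsEigenvalue : Matrix n → Carrier → Set (c ⊔ ℓ₁)
  IsEigenvalue M a = ∃[ x ] (¬ (x ≈ᵛ λ _ → 0#)) × Eigenspace M a x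

  combination : ∀ {k} → Vector Carrier k → (Fin k → Vector Carrier n) →
                Vector Carrier n
  combination a b i = sum (λ j → a j * b j i)

  record Basis (V : Pred (Vector Carrier n) ℓ₁) (k : ℕ) : Set (c ⊔ ℓ₁) where
    field
      basis       : Fin k → Vector Carrier n
      inSubspace  : ∀ j → V (basis j)
      independent : ∀ a → combination a basis ≈ᵛ (λ _ → 0#) → ∀ j → a j ≈ 0#
      spanning    : ∀ x → V x → ∃[ a ] x ≈ᵛ combination a basis

  -- The n eigenvalues of an n × n matrix, counted with multiplicity: each
  -- a occurs as often as the dimension of its eigenspace (0 when a is not
  -- an eigenvalue).  For the symmetric matrices used here geometric and
  -- algebraic multiplicities agree and, over the real numbers, the spectral
  -- theorem provides such a family, unique up to reordering.
  record Spectrum {n} (M : Matrix n) : Set (c ⊔ ℓ₁) where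
    field
      eigenvalue   : Fin n → Carrier
      multiplicity : ∀ a → Basis (Eigenspace M a) (count (λ i → eigenvalue i ≟ a))

  adjacency : Graph n → Matrix n
  adjacency G x y = if does (adj? G x y) then 1# else 0#

  signlessLaplacian : Graph n → Matrix n
  signlessLaplacian G x y =
    adjacency G x y + diagonal (λ z → degree G z ×# 1#) x y

  -- The number of positive minus the number of negative eigenvalues of the
  -- adjacency matrix.
  signature : (G : Graph n) → Spectrum (adjacency G) → ℤ
  signature G σ = count (λ i → 0# <? eigenvalue i) ⊖ count (λ i → eigenvalue i <? 0#)
    where open Spectrum σ

  φ : (G : Graph n) → Inverse (signlessLaplacian G −ᴹ scalar 2#) → Fin n → Carrier
  φ G W x = Inverse.matrix W x x

{-# OPTIONS --safe #-}
module Submission where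

-- With B the incidence matrix, Q(G) = BBᵀ and A(L(G)) = BᵀB - 2I.  The row of
-- A(L(G₁ ∪ G₂ + uv)) belonging to the edge uv consists of B₁ᵀe_u and B₂ᵀe_v,
-- and A(L(Gᵢ)) maps Bᵢᵀ(Q(Gᵢ) - 2I)⁻¹e to Bᵢᵀe.  Hence eliminating the edge uv
-- is a congruence from A(L(G)) to A(L(G₁)) ⊕ A(L(G₂)) ⊕ (c) whose Schur
-- complement is c = -2 (1 + φ(u) + φ(v)) < 0, and all three adjacency forms are
-- nondegenerate.  The signatures then add up as in Sylvester's law of inertia: a
-- positive definite and a negative definite subspace meet trivially, so their
-- dimensions sum to at most that of the whole space.

open import Defs
open import Algebra.Bundles using (CommutativeMonoid; CommutativeRing; RawRing)
import Algebra.Definitions.RawMonoid as RawMonoidDefinitions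
import Algebra.Properties.CommutativeMonoid.Sum as MonoidSum
import Algebra.Properties.CommutativeSemigroup as CommutativeSemigroupProperties
import Algebra.Properties.Ring as RingProperties
import Algebra.Properties.Semiring.Mult as SemiringMult
import Algebra.Properties.Semiring.Sum as SemiringSum
import Algebra.Solver.Ring as RingSolver
open import Algebra.Solver.Ring.AlmostCommutativeRing
  using (fromCommutativeRing; _-Raw-AlmostCommutative⟶_)
open import Data.Bool.Base using (if_then_else_)
open import Data.Fin.Base using (Fin; zero; suc; toℕ; splitAt; _↑ˡ_; _↑ʳ_) renaming (_<_ to _<ᶠ_)
open import Data.Fin.Properties
  using (splitAt-↑ˡ; splitAt-↑ʳ; ↑ˡ-injective; ↑ʳ-injective; toℕ-↑ˡ; toℕ-↑ʳ; toℕ<n; suc-injective)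
  renaming (_≟_ to _≟ᶠ_; _<?_ to _<ᶠ?_; <-irrefl to <ᶠ-irrefl; <-asym to <ᶠ-asym; <-cmp to <ᶠ-cmp)
open import Data.Integer.Base using (1ℤ; +_; _⊖_) renaming (_+_ to _+ᶻ_; _-_ to _-ᶻ_)
import Data.Integer.Properties as ℤₚ
import Data.Integer.Solver as ℤSolver
open import Data.List.Base
  using (List; []; _∷_; _++_; allFin; cartesianProduct; filter; length; lookup; tabulate)
  renaming (map to mapᴸ)
open import Data.List.Membership.Propositional using (_∈_)
open import Data.List.Membership.Propositional.Properties
  using (∈-allFin; ∈-filter⁺; ∈-filter⁻; ∈-length; ∈-lookup)
open import Data.List.Properties using (filter-all; length-tabulate)
import Data.List.Relation.Unary.All as All
open import Data.List.Relation.Unary.AllPairs using (_∷_)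
open import Data.List.Relation.Unary.Any using (here)
open import Data.List.Relation.Unary.Unique.Propositional using (Unique)
open import Data.List.Relation.Unary.Unique.Propositional.Properties
  using (allFin⁺; cartesianProduct⁺; filter⁺)
open import Data.Maybe.Base using (Maybe; just; nothing)
open import Data.Nat.Base as ℕ using (ℕ; zero; suc; _≤_; z≤n; s≤s)
import Data.Nat.Properties as ℕₚ
open import Data.Product.Base using (_×_; _,_; proj₁; proj₂; ∃-syntax)
open import Data.Product.Properties using (≡-dec)
open import Data.Sum.Base as Sum using (_⊎_; inj₁; inj₂)
open import Data.Unit.Polymorphic.Base using (⊤; tt)
open import Data.Vec.Functional using (Vector)
open import Function.Base using (_∘_; id)
open import Level using (_⊔_) renaming (suc to lsuc)
open import Relation.Binary.Definitions using (tri<; tri≈; tri>)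
open import Relation.Binary.PropositionalEquality as ≡ using (_≡_; _≢_)
import Relation.Binary.Reasoning.Setoid as SetoidReasoning
open import Relation.Binary.Structures using (IsStrictTotalOrder)
open import Relation.Nullary.Decidable using (Dec; does; yes; no; ¬?; _×-dec_)
open import Relation.Nullary.Negation using (¬_; contradiction)
open import Relation.Unary using (Pred; Decidable)
open Graph using (Adj; adj?)

-- The scalars form an ordered field only, so square roots, and with them orthonormal eigenvectors,
-- may be missing. A `Spectrum` supplies just a basis of each eigenspace. This is enough: on the
-- eigenspace of e the form of the matrix is e⟨x,x⟩ in any basis, and different eigenspaces of a
-- symmetric matrix are orthogonal, so the bases together span definite subspaces of dimensions
-- `#pos` and `#neg`. The congruence is used in one direction: it carries definite subspaces for G₁
-- and G₂ to definite subspaces for G. This bounds both indices of G from below; nondegeneracy fixes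
-- their sum and so forces equality. Origin of c: let g = (Q(Gᵢ) - 2I)⁻¹e. The edge uv has diagonal
-- entry 0, and its elimination subtracts for each side ⟨Bᵀg, Bᵀe⟩ = (Qg)(u) = 2φ(u) + 1,
-- respectively 2φ(v) + 1. The total is -2(1 + φ(u) + φ(v)). The computation itself uses the form as
-- |Bx|² - 2|x|², because norms split along the vertices and along the edges of G, whereas the
-- entries of A(L(G)) are tied to positions in an edge list.

-- Integer coefficients, as differences of natural numbers, are what lets the
-- ring solver cancel.
module CommutativeRingSolver {c ℓ} (R : CommutativeRing c ℓ) where

  open CommutativeRing R
  open RingProperties ring
  open SemiringMult semiring using (×1-homo-*; ×-homo-+) renaming (_×_ to _×#_)
  open SetoidReasoning setoid
  open import Algebra.Properties.CommutativeSemigroup +-commutativeSemigroup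
    using (interchange)

  private
    coefficients : RawRing _ _
    coefficients = record
      { Carrier = ℕ × ℕ
      ; _≈_     = _≡_
      ; _+_     = λ (a , b) (c , d) → a ℕ.+ c , b ℕ.+ d
      ; _*_     = λ (a , b) (c , d) → a ℕ.* c ℕ.+ b ℕ.* d , a ℕ.* d ℕ.+ b ℕ.* c
      ; -_      = λ (a , b) → b , a
      ; 0#      = 0 , 0
      ; 1#      = 1 , 0
      }

    ν : ℕ → Carrier
    ν n = n ×# 1#

    ⟦_⟧ : ℕ × ℕ → Carrier
    ⟦ a , b ⟧ = ν a - ν b

    sub-interchange : ∀ w x y z → (w + x) - (y + z) ≈ (w - y) + (x - z)
    sub-interchange w x y z = begin
      (w + x) - (y + z)      ≈⟨ +-congˡ (-‿+-comm y z) ⟨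
      (w + x) + (- y + - z)  ≈⟨ interchange w x (- y) (- z) ⟩
      (w - y) + (x - z)      ∎

    ν-homo : ∀ a b c d → ν (a ℕ.* b ℕ.+ c ℕ.* d) ≈ ν a * ν b + ν c * ν d
    ν-homo a b c d =
      trans (×-homo-+ 1# (a ℕ.* b) (c ℕ.* d))
            (+-cong (×1-homo-* a b) (×1-homo-* c d))

    *-homo : ∀ x y → ⟦ RawRing._*_ coefficients x y ⟧ ≈ ⟦ x ⟧ * ⟦ y ⟧
    *-homo (a , b) (c , d) = begin
      ν (a ℕ.* c ℕ.+ b ℕ.* d) - ν (a ℕ.* d ℕ.+ b ℕ.* c)
        ≈⟨ +-cong (ν-homo a c b d) (-‿cong (ν-homo a d b c)) ⟩
      (ν a * ν c + ν b * ν d) - (ν a * ν d + ν b * ν c)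
        ≈⟨ +-congˡ (-‿cong (+-comm _ _)) ⟩
      (ν a * ν c + ν b * ν d) - (ν b * ν c + ν a * ν d)
        ≈⟨ sub-interchange _ _ _ _ ⟩
      (ν a * ν c - ν b * ν c) + (ν b * ν d - ν a * ν d)
        ≈⟨ +-cong ([y-z]x≈yx-zx _ _ _) ([y-z]x≈yx-zx _ _ _) ⟨
      (ν a - ν b) * ν c + (ν b - ν a) * ν d
        ≈⟨ +-congˡ (*-congʳ (sym (⁻¹-anti-homo‿- _ _))) ⟩
      (ν a - ν b) * ν c + (- (ν a - ν b)) * ν d
        ≈⟨ +-congˡ (trans (sym (-‿distribˡ-* _ _)) (-‿distribʳ-* _ _)) ⟩
      (ν a - ν b) * ν c + (ν a - ν b) * (- ν d)
        ≈⟨ distribˡ _ _ _ ⟨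
      (ν a - ν b) * (ν c - ν d) ∎

    morphism : coefficients -Raw-AlmostCommutative⟶ fromCommutativeRing R
    morphism = record
      { ⟦_⟧    = ⟦_⟧
      ; +-homo = λ (a , b) (c , d) →
          trans (+-cong (×-homo-+ 1# a c) (-‿cong (×-homo-+ 1# b d)))
                (sub-interchange _ _ _ _)
      ; *-homo = *-homo
      ; -‿homo = λ (a , b) → sym (⁻¹-anti-homo‿- (ν a) (ν b))
      ; 0-homo = -‿inverseʳ 0#
      ; 1-homo = trans (+-cong (+-identityʳ 1#) -0#≈0#) (+-identityʳ 1#)
      }

    -- Different pairs can denote the same integer, so a - b and c - d are compared through a + d =
    -- c + b.
    _≟ᶜ_ : ∀ x y → Maybe (⟦ x ⟧ ≈ ⟦ y ⟧)
    (a , b) ≟ᶜ (c , d) with a ℕ.+ d ℕₚ.≟ c ℕ.+ b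
    ... | no  _  = nothing
    ... | yes eq = just (begin
      ν a - ν b                      ≈⟨ +-identityʳ _ ⟨
      (ν a - ν b) + 0#               ≈⟨ +-congˡ (-‿inverseʳ (ν d)) ⟨
      (ν a - ν b) + (ν d - ν d)      ≈⟨ sub-interchange _ _ _ _ ⟨
      (ν a + ν d) - (ν b + ν d)      ≈⟨ +-cong ad≈cb (-‿cong (+-comm _ _)) ⟩
      (ν c + ν b) - (ν d + ν b)      ≈⟨ sub-interchange _ _ _ _ ⟩
      (ν c - ν d) + (ν b - ν b)      ≈⟨ +-congˡ (-‿inverseʳ (ν b)) ⟩
      (ν c - ν d) + 0#               ≈⟨ +-identityʳ _ ⟩
      ν c - ν d                      ∎)
      where
      ad≈cb : ν a + ν d ≈ ν c + ν b
      ad≈cb = trans (sym (×-homo-+ 1# a d))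
        (trans (reflexive (≡.cong ν eq)) (×-homo-+ 1# c b))

  open RingSolver coefficients (fromCommutativeRing R) morphism _≟ᶜ_ public
    using (solve; _:+_; _:*_; _:-_; :-_; _:=_)

-- Counting

filter-partition :
  ∀ {a p q r} {A : Set a} {P : Pred A p} {Q : Pred A q} {R : Pred A r}
  (P? : Decidable P) (Q? : Decidable Q) (R? : Decidable R) →
  (∀ x → P x → Q x ⊎ R x) → (∀ x → Q x → P x) → (∀ x → R x → P x) →
  (∀ x → Q x → ¬ R x) → ∀ xs →
  length (filter P? xs) ≡ length (filter Q? xs) ℕ.+ length (filter R? xs)
filter-partition P? Q? R? split Q⊆P R⊆P disjoint [] = ≡.refl
filter-partition P? Q? R? split Q⊆P R⊆P disjoint (x ∷ xs)
  with filter-partition P? Q? R? split Q⊆P R⊆P disjoint xs | P? x | Q? x | R? x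
... | ih | yes _  | yes _ | no  _ = ≡.cong suc ih
... | ih | yes _  | no  _ | yes _ = ≡.trans (≡.cong suc ih) (≡.sym (ℕₚ.+-suc _ _))
... | ih | no  _  | no  _ | no  _ = ih
... | ih | _      | yes q | yes r = contradiction r (disjoint x q)
... | ih | no ¬p  | yes q | _     = contradiction (Q⊆P x q) ¬p
... | ih | no ¬p  | _     | yes r = contradiction (R⊆P x r) ¬p
... | ih | yes p  | no ¬q | no ¬r with split x p
...   | inj₁ q = contradiction q ¬q
...   | inj₂ r = contradiction r ¬r

-- Serves to remove one eigenvalue from a set of positions and to divide a spectrum by sign.
count-partition :
  ∀ {n p q r} {P : Pred (Fin n) p} {Q : Pred (Fin n) q} {R : Pred (Fin n) r}
  (P? : Decidable P) (Q? : Decidable Q) (R? : Decidable R) →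
  (∀ x → P x → Q x ⊎ R x) → (∀ x → Q x → P x) → (∀ x → R x → P x) →
  (∀ x → Q x → ¬ R x) → count P? ≡ count Q? ℕ.+ count R?
count-partition {n} P? Q? R? split Q⊆P R⊆P disjoint =
  filter-partition P? Q? R? split Q⊆P R⊆P disjoint (allFin n)

count-all : ∀ {n p} {P : Pred (Fin n) p} (P? : Decidable P) → (∀ x → P x) → count P? ≡ n
count-all {n} P? all = ≡.trans
  (≡.cong length (filter-all P? (All.universal all (allFin n))))
  (length-tabulate {n = n} id)

count>0 : ∀ {n p} {P : Pred (Fin n) p} (P? : Decidable P) {i} → P i → 0 ℕ.< count P?
count>0 P? {i} p = ∈-length (∈-filter⁺ P? (∈-allFin i) p)

count≡0⊎∃ : ∀ {n p} {P : Pred (Fin n) p} (P? : Decidable P) → count P? ≡ 0 ⊎ ∃[ i ] P i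
count≡0⊎∃ {n} P? with filter P? (allFin n) in eq
... | []    = inj₁ ≡.refl
... | i ∷ _ = inj₂ (i , proj₂ (∈-filter⁻ P? {xs = allFin n} (≡.subst (i ∈_) (≡.sym eq) (here ≡.refl))))

↑-elim : ∀ {p} {k} l (P : Fin (k ℕ.+ l) → Set p) →
         (∀ i → P (i ↑ˡ l)) → (∀ j → P (k ↑ʳ j)) → ∀ i → P i
↑-elim {k = zero}  l P left right i       = right i
↑-elim {k = suc k} l P left right zero    = left zero
↑-elim {k = suc k} l P left right (suc i) = ↑-elim l (P ∘ suc) (left ∘ suc) right i

-- Sums over edges

edge : ∀ {n} (G : Graph n) → Fin (size G) → Fin n × Fin n
edge G = lookup (edges G)

module _ {n₁ n₂} (G₁ : Graph n₁) (G₂ : Graph n₂) (u : Fin n₁) (v : Fin n₂) where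

  private G = joinByEdge G₁ G₂ u v

  join-LL⁻ : ∀ {a b} → Adj G (a ↑ˡ n₂) (b ↑ˡ n₂) → Adj G₁ a b
  join-LL⁻ {a} {b} adj rewrite splitAt-↑ˡ n₁ a n₂ | splitAt-↑ˡ n₁ b n₂ = adj

  join-LL⁺ : ∀ {a b} → Adj G₁ a b → Adj G (a ↑ˡ n₂) (b ↑ˡ n₂)
  join-LL⁺ {a} {b} adj rewrite splitAt-↑ˡ n₁ a n₂ | splitAt-↑ˡ n₁ b n₂ = adj

  join-RR⁻ : ∀ {a b} → Adj G (n₁ ↑ʳ a) (n₁ ↑ʳ b) → Adj G₂ a b
  join-RR⁻ {a} {b} adj rewrite splitAt-↑ʳ n₁ n₂ a | splitAt-↑ʳ n₁ n₂ b = adj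

  join-RR⁺ : ∀ {a b} → Adj G₂ a b → Adj G (n₁ ↑ʳ a) (n₁ ↑ʳ b)
  join-RR⁺ {a} {b} adj rewrite splitAt-↑ʳ n₁ n₂ a | splitAt-↑ʳ n₁ n₂ b = adj

  join-LR⁻ : ∀ {a b} → Adj G (a ↑ˡ n₂) (n₁ ↑ʳ b) → a ≡ u × b ≡ v
  join-LR⁻ {a} {b} adj rewrite splitAt-↑ˡ n₁ a n₂ | splitAt-↑ʳ n₁ n₂ b = adj

  join-LR⁺ : Adj G (u ↑ˡ n₂) (n₁ ↑ʳ v)
  join-LR⁺ rewrite splitAt-↑ˡ n₁ u n₂ | splitAt-↑ʳ n₁ n₂ v = ≡.refl , ≡.refl

↑ˡ<↑ʳ : ∀ {m n} (a : Fin m) (b : Fin n) → a ↑ˡ n <ᶠ m ↑ʳ b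
↑ˡ<↑ʳ {m} {n} a b = ≡.subst₂ ℕ._<_ (≡.sym (toℕ-↑ˡ a n)) (≡.sym (toℕ-↑ʳ m b))
  (ℕₚ.≤-trans (toℕ<n a) (ℕₚ.m≤m+n m (toℕ b)))

-- Stated for any commutative monoid because it is used twice: with natural numbers to count edges,
-- and with field elements.
module Sums {c ℓ} (K : CommutativeMonoid c ℓ) where

  open CommutativeMonoid K
  open MonoidSum K using (sum; sum-cong-≋; sum-replicate-zero; ∑-distrib-+)
  open SetoidReasoning setoid

  sum-zero : ∀ {n} {f : Vector Carrier n} → (∀ i → f i ≈ ε) → sum f ≈ ε
  sum-zero {n} f≈ε = trans (sum-cong-≋ f≈ε) (sum-replicate-zero n)

  sum-only : ∀ {n} (f : Vector Carrier n) i → (∀ j → j ≢ i → f j ≈ ε) → sum f ≈ f i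
  sum-only f zero    f≈ε =
    trans (∙-congˡ (sum-zero (λ j → f≈ε (suc j) λ ()))) (identityʳ _)
  sum-only f (suc i) f≈ε = trans
    (∙-cong (f≈ε zero λ ()) (sum-only (f ∘ suc) i (λ j j≢i → f≈ε (suc j) (j≢i ∘ suc-injective))))
    (identityˡ _)

  sum-↑ : ∀ m {n} (f : Vector Carrier (m ℕ.+ n)) →
          sum f ≈ sum (f ∘ (_↑ˡ n)) ∙ sum (f ∘ (m ↑ʳ_))
  sum-↑ zero    f = sym (identityˡ _)
  sum-↑ (suc m) f = trans (∙-congˡ (sum-↑ m (f ∘ suc))) (sym (assoc _ _ _))

  -- Over the field this unfolds to the same conditional as the entries of `adjacency` and
  -- `diagonal`, so the facts about it apply to them directly.
  when : ∀ {p} {P : Set p} → Dec P → Carrier → Carrier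
  when P? x = if does P? then x else ε

  when-yes : ∀ {p} {P : Set p} (P? : Dec P) {x} → P → when P? x ≈ x
  when-yes (yes _) _ = refl
  when-yes (no ¬p) p = contradiction p ¬p

  when-no : ∀ {p} {P : Set p} (P? : Dec P) {x} → ¬ P → when P? x ≈ ε
  when-no (yes p) ¬p = contradiction p ¬p
  when-no (no _)  _  = refl

  when-⇔ : ∀ {p q} {P : Set p} {Q : Set q} (P? : Dec P) (Q? : Dec Q) {x} →
           (P → Q) → (Q → P) → when P? x ≈ when Q? x
  when-⇔ (yes p) Q? to from = sym (when-yes Q? (to p))
  when-⇔ (no ¬p) Q? to from = sym (when-no Q? (¬p ∘ from))

  sumᴸ : ∀ {a} {A : Set a} → (A → Carrier) → List A → Carrier
  sumᴸ f xs = sum (λ i → f (lookup xs i))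

  sumᴸ-tabulate : ∀ {a} {A : Set a} (f : A → Carrier) {n} (g : Fin n → A) →
                  sumᴸ f (tabulate g) ≈ sum (f ∘ g)
  sumᴸ-tabulate f {zero}  g = refl
  sumᴸ-tabulate f {suc n} g = ∙-congˡ (sumᴸ-tabulate f (g ∘ suc))

  sumᴸ-map : ∀ {a b} {A : Set a} {B : Set b} (f : B → Carrier) (g : A → B) xs →
             sumᴸ f (mapᴸ g xs) ≈ sumᴸ (f ∘ g) xs
  sumᴸ-map f g []       = refl
  sumᴸ-map f g (x ∷ xs) = ∙-congˡ (sumᴸ-map f g xs)

  sumᴸ-++ : ∀ {a} {A : Set a} (f : A → Carrier) xs ys →
            sumᴸ f (xs ++ ys) ≈ sumᴸ f xs ∙ sumᴸ f ys
  sumᴸ-++ f []       ys = sym (identityˡ _)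
  sumᴸ-++ f (x ∷ xs) ys = trans (∙-congˡ (sumᴸ-++ f xs ys)) (sym (assoc _ _ _))

  sumᴸ-filter : ∀ {a p} {A : Set a} {P : Pred A p} (P? : Decidable P) (f : A → Carrier) xs →
                sumᴸ f (filter P? xs) ≈ sumᴸ (λ x → when (P? x) (f x)) xs
  sumᴸ-filter P? f []       = refl
  sumᴸ-filter P? f (x ∷ xs) with P? x
  ... | yes _ = ∙-congˡ (sumᴸ-filter P? f xs)
  ... | no  _ = trans (sumᴸ-filter P? f xs) (sym (identityˡ _))

  sumᴸ-cartesianProduct : ∀ {a b} {A : Set a} {B : Set b} (f : A × B → Carrier) xs ys →
    sumᴸ f (cartesianProduct xs ys) ≈ sumᴸ (λ x → sumᴸ (λ y → f (x , y)) ys) xs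
  sumᴸ-cartesianProduct f []       ys = refl
  sumᴸ-cartesianProduct f (x ∷ xs) ys = trans (sumᴸ-++ f (mapᴸ (x ,_) ys) _)
    (∙-cong (sumᴸ-map f (x ,_) ys) (sumᴸ-cartesianProduct f xs ys))

  -- With x = 1 this turns a vertex degree, which is a count, into a row sum of the adjacency
  -- matrix.
  sum-count : ∀ {n p} {P : Pred (Fin n) p} (P? : Decidable P) x →
              sum {count P?} (λ _ → x) ≈ sum (λ i → when (P? i) x)
  sum-count {n} P? x = trans (sumᴸ-filter P? (λ _ → x) (allFin n))
                             (sumᴸ-tabulate (λ i → when (P? i) x) id)

  isEdge? : ∀ {n} (G : Graph n) a b → Dec (a <ᶠ b × Adj G a b)
  isEdge? G a b = (a <ᶠ? b) ×-dec adj? G a b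

  -- Eliminates list positions in favour of ordered pairs of vertices, which can be compared between
  -- different graphs.
  edge-sum : ∀ {n} (G : Graph n) (f : Fin n × Fin n → Carrier) →
             sum (f ∘ edge G) ≈ sum (λ a → sum (λ b → when (isEdge? G a b) (f (a , b))))
  edge-sum {n} G f = begin
    sumᴸ f (edges G)
      ≈⟨ sumᴸ-filter (λ (a , b) → isEdge? G a b) f (cartesianProduct (allFin n) (allFin n)) ⟩
    sumᴸ h (cartesianProduct (allFin n) (allFin n))
      ≈⟨ sumᴸ-cartesianProduct h (allFin n) (allFin n) ⟩
    sumᴸ (λ a → sumᴸ (λ b → h (a , b)) (allFin n)) (allFin n)
      ≈⟨ sumᴸ-tabulate (λ a → sumᴸ (λ b → h (a , b)) (allFin n)) {n} id ⟩
    sum (λ a → sumᴸ (λ b → h (a , b)) (allFin n))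
      ≈⟨ sum-cong-≋ (λ a → sumᴸ-tabulate (λ b → h (a , b)) id) ⟩
    sum (λ a → sum (λ b → h (a , b))) ∎
    where
    h : Fin n × Fin n → Carrier
    h (a , b) = when (isEdge? G a b) (f (a , b))

  -- The edge list of the joined graph is not a concatenation of the other lists, and no bijection
  -- of positions is constructed. As sums over ordered pairs both sides split into blocks: the
  -- right-left block is empty because left vertices precede right ones, and the left-right block
  -- holds only uv.
  join-edge-sum : ∀ {n₁ n₂} (G₁ : Graph n₁) (G₂ : Graph n₂) (u : Fin n₁) (v : Fin n₂) →
    let G = joinByEdge G₁ G₂ u v in
    (f : Fin (n₁ ℕ.+ n₂) × Fin (n₁ ℕ.+ n₂) → Carrier) →
    sum (f ∘ edge G) ≈
      (sum (λ i → f (proj₁ (edge G₁ i) ↑ˡ n₂ , proj₂ (edge G₁ i) ↑ˡ n₂)) ∙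
       sum (λ i → f (n₁ ↑ʳ proj₁ (edge G₂ i) , n₁ ↑ʳ proj₂ (edge G₂ i)))) ∙
      f (u ↑ˡ n₂ , n₁ ↑ʳ v)
  join-edge-sum {n₁} {n₂} G₁ G₂ u v f = begin
    sum (f ∘ edge G)
      ≈⟨ edge-sum G f ⟩
    sum (λ a → sum (h a))
      ≈⟨ sum-↑ n₁ (λ a → sum (h a)) ⟩
    sum (λ a → sum (h (a ↑ˡ n₂))) ∙ sum (λ a → sum (h (n₁ ↑ʳ a)))
      ≈⟨ ∙-cong (trans (sum-cong-≋ (λ a → sum-↑ n₁ (h (a ↑ˡ n₂))))
                       (∑-distrib-+ (λ a → sum (λ b → h (a ↑ˡ n₂) (b ↑ˡ n₂))) _))
                (sum-cong-≋ (λ a → trans (sum-↑ n₁ (h (n₁ ↑ʳ a))) (trans (∙-congʳ (sum-zero (RL a))) (identityˡ _)))) ⟩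
    (sum (λ a → sum (λ b → h (a ↑ˡ n₂) (b ↑ˡ n₂))) ∙ sum (λ a → sum (λ b → h (a ↑ˡ n₂) (n₁ ↑ʳ b))))
      ∙ sum (λ a → sum (λ b → h (n₁ ↑ʳ a) (n₁ ↑ʳ b)))
      ≈⟨ ∙-cong (∙-cong (sum-cong-≋ (λ a → sum-cong-≋ (LL a))) LR)
                (sum-cong-≋ (λ a → sum-cong-≋ (RR a))) ⟩
    (sum (λ a → sum (λ b → when (isEdge? G₁ a b) (f (a ↑ˡ n₂ , b ↑ˡ n₂)))) ∙ f (u ↑ˡ n₂ , n₁ ↑ʳ v))
      ∙ sum (λ a → sum (λ b → when (isEdge? G₂ a b) (f (n₁ ↑ʳ a , n₁ ↑ʳ b))))
      ≈⟨ ∙-cong (∙-congʳ (edge-sum G₁ (λ (a , b) → f (a ↑ˡ n₂ , b ↑ˡ n₂))))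
                (edge-sum G₂ (λ (a , b) → f (n₁ ↑ʳ a , n₁ ↑ʳ b))) ⟨
    (s₁ ∙ w) ∙ s₂   ≈⟨ assoc s₁ w s₂ ⟩
    s₁ ∙ (w ∙ s₂)   ≈⟨ ∙-congˡ (comm w s₂) ⟩
    s₁ ∙ (s₂ ∙ w)   ≈⟨ assoc s₁ s₂ w ⟨
    (s₁ ∙ s₂) ∙ w   ∎
    where
    G = joinByEdge G₁ G₂ u v
    s₁ = sum (λ i → f (proj₁ (edge G₁ i) ↑ˡ n₂ , proj₂ (edge G₁ i) ↑ˡ n₂))
    s₂ = sum (λ i → f (n₁ ↑ʳ proj₁ (edge G₂ i) , n₁ ↑ʳ proj₂ (edge G₂ i)))
    w  = f (u ↑ˡ n₂ , n₁ ↑ʳ v)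

    h : Fin (n₁ ℕ.+ n₂) → Fin (n₁ ℕ.+ n₂) → Carrier
    h a b = when (isEdge? G a b) (f (a , b))

    LL : ∀ a b → h (a ↑ˡ n₂) (b ↑ˡ n₂) ≈ when (isEdge? G₁ a b) (f (a ↑ˡ n₂ , b ↑ˡ n₂))
    LL a b = when-⇔ (isEdge? G (a ↑ˡ n₂) (b ↑ˡ n₂)) (isEdge? G₁ a b)
      (λ (a<b , adj) → ≡.subst₂ ℕ._<_ (toℕ-↑ˡ a n₂) (toℕ-↑ˡ b n₂) a<b , join-LL⁻ G₁ G₂ u v adj)
      (λ (a<b , adj) → ≡.subst₂ ℕ._<_ (≡.sym (toℕ-↑ˡ a n₂)) (≡.sym (toℕ-↑ˡ b n₂)) a<b ,
                        join-LL⁺ G₁ G₂ u v adj)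

    RR : ∀ a b → h (n₁ ↑ʳ a) (n₁ ↑ʳ b) ≈ when (isEdge? G₂ a b) (f (n₁ ↑ʳ a , n₁ ↑ʳ b))
    RR a b = when-⇔ (isEdge? G (n₁ ↑ʳ a) (n₁ ↑ʳ b)) (isEdge? G₂ a b)
      (λ (a<b , adj) → ℕₚ.+-cancelˡ-< n₁ _ _ (≡.subst₂ ℕ._<_ (toℕ-↑ʳ n₁ a) (toℕ-↑ʳ n₁ b) a<b) ,
                        join-RR⁻ G₁ G₂ u v adj)
      (λ (a<b , adj) → ≡.subst₂ ℕ._<_ (≡.sym (toℕ-↑ʳ n₁ a)) (≡.sym (toℕ-↑ʳ n₁ b)) (ℕₚ.+-monoʳ-< n₁ a<b) ,
                        join-RR⁺ G₁ G₂ u v adj)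

    RL : ∀ a b → h (n₁ ↑ʳ a) (b ↑ˡ n₂) ≈ ε
    RL a b = when-no (isEdge? G (n₁ ↑ʳ a) (b ↑ˡ n₂)) (λ (a<b , _) → ℕₚ.<-asym a<b (↑ˡ<↑ʳ b a))

    LR : sum (λ a → sum (λ b → h (a ↑ˡ n₂) (n₁ ↑ʳ b))) ≈ w
    LR = trans
      (sum-only (λ a → sum (λ b → h (a ↑ˡ n₂) (n₁ ↑ʳ b))) u (λ a a≢u → sum-zero (λ b →
        when-no (isEdge? G (a ↑ˡ n₂) (n₁ ↑ʳ b)) (λ (_ , adj) → a≢u (proj₁ (join-LR⁻ G₁ G₂ u v adj))))))
      (trans
        (sum-only (λ b → h (u ↑ˡ n₂) (n₁ ↑ʳ b)) v (λ b b≢v →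
          when-no (isEdge? G (u ↑ˡ n₂) (n₁ ↑ʳ b)) (λ (_ , adj) → b≢v (proj₂ (join-LR⁻ G₁ G₂ u v adj)))))
        (when-yes (isEdge? G (u ↑ˡ n₂) (n₁ ↑ʳ v)) (↑ˡ<↑ʳ u v , join-LR⁺ G₁ G₂ u v)))

-- `join-edge-sum` for the constant 1 in the additive monoid of natural numbers.
size-join : ∀ {n₁ n₂} (G₁ : Graph n₁) (G₂ : Graph n₂) (u : Fin n₁) (v : Fin n₂) →
            size (joinByEdge G₁ G₂ u v) ≡ suc (size G₁ ℕ.+ size G₂)
size-join G₁ G₂ u v = ≡.trans (≡.sym (sum-1 _)) (≡.trans (join-edge-sum G₁ G₂ u v (λ _ → 1))
  (≡.trans (≡.cong₂ (λ a b → (a ℕ.+ b) ℕ.+ 1) (sum-1 (size G₁)) (sum-1 (size G₂))) (ℕₚ.+-comm _ 1)))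
  where
  open Sums ℕₚ.+-0-commutativeMonoid
  open MonoidSum ℕₚ.+-0-commutativeMonoid using (sum)
  sum-1 : ∀ n → sum {n} (λ _ → 1) ≡ n
  sum-1 zero    = ≡.refl
  sum-1 (suc n) = ≡.cong suc (sum-1 n)

edges-unique : ∀ {n} (G : Graph n) → Unique (edges G)
edges-unique {n} G = filter⁺ _ (cartesianProduct⁺ (allFin⁺ n) (allFin⁺ n))

lookup-injective : ∀ {a} {A : Set a} {xs} → Unique {A = A} xs →
                   ∀ i j → lookup xs i ≡ lookup xs j → i ≡ j
lookup-injective (_ ∷ _)  zero    zero    _  = ≡.refl
lookup-injective (x∉ ∷ _) zero    (suc j) eq = contradiction eq (All.lookup x∉ (∈-lookup j))
lookup-injective (x∉ ∷ _) (suc i) zero    eq = contradiction (≡.sym eq) (All.lookup x∉ (∈-lookup i))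
lookup-injective (_ ∷ xs) (suc i) (suc j) eq = ≡.cong suc (lookup-injective xs i j eq)

edge-injective : ∀ {n} (G : Graph n) {i j} → edge G i ≡ edge G j → i ≡ j
edge-injective G eq = lookup-injective (edges-unique G) _ _ eq

edge-< : ∀ {n} (G : Graph n) i → proj₁ (edge G i) <ᶠ proj₂ (edge G i)
edge-< {n} G i =
  proj₁ (proj₂ (∈-filter⁻ _ {xs = cartesianProduct (allFin n) (allFin n)} (∈-lookup {xs = edges G} i)))

module LineGraphSignature {c ℓ₁ ℓ₂} (F : OrderedField c ℓ₁ ℓ₂) where

  open Spectral F
  open CommutativeRing commutativeRing
    hiding (Carrier; _≈_; _+_; _*_; -_; 0#; 1#; _-_; semiring; +-rawMonoid; zero)
    renaming (refl to ≈-refl; sym to ≈-sym; trans to ≈-trans)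
  open IsStrictTotalOrder isStrictTotalOrder
    using (<-resp-≈; asym) renaming (irrefl to <-irrefl; trans to <-trans)
  open RawMonoidDefinitions +-rawMonoid using () renaming (_×_ to _×#_)
  open SemiringSum semiring
    using (sum; sum-cong-≋; sum-replicate; ∑-distrib-+; ∑-comm; *-distribˡ-sum; *-distribʳ-sum)
  open CommutativeRingSolver commutativeRing
  open RingProperties ring
    using (x+x≈x⇒x≈0; x≈y⇒x∙y⁻¹≈ε; x∙y⁻¹≈ε⇒x≈y; +-inverseˡ-unique; -0#≈0#; x≈z//y)
  open Sums +-commutativeMonoid
  open SetoidReasoning setoid

  -- Vectors and linear maps

  <-respʳ : ∀ {x y z} → y ≈ z → x < y → x < z
  <-respʳ = proj₁ <-resp-≈

  <-respˡ : ∀ {x y z} → y ≈ z → y < x → z < x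
  <-respˡ = proj₂ <-resp-≈

  neg-pos : ∀ {x} → x < 0# → 0# < - x
  neg-pos {x} x<0 =
    <-respˡ (-‿inverseʳ x) (<-respʳ (+-identityˡ _) (+-monoˡ-< (- x) x<0))

  pos-neg : ∀ {x} → 0# < - x → x < 0#
  pos-neg {x} 0<-x =
    <-respˡ (+-identityˡ x) (<-respʳ (-‿inverseˡ x) (+-monoˡ-< x 0<-x))

  +-pos : ∀ {x y} → 0# < x → 0# < y → 0# < x + y
  +-pos {x} {y} 0<x 0<y = <-trans 0<y (<-respˡ (+-identityˡ y) (+-monoˡ-< y 0<x))

  zero⊎square-pos : ∀ x → x ≈ 0# ⊎ 0# < x * x
  zero⊎square-pos x with compare x 0#
  ... | tri≈ _ x≈0 _ = inj₁ x≈0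
  ... | tri> _ _ 0<x = inj₂ (*-pos 0<x 0<x)
  ... | tri< x<0 _ _ = inj₂ (<-respʳ (solve 1 (λ x → (:- x) :* (:- x) := x :* x) ≈-refl x)
                                     (*-pos (neg-pos x<0) (neg-pos x<0)))

  0<1 : 0# < 1#
  0<1 with zero⊎square-pos 1#
  ... | inj₁ 1≈0 = contradiction (≈-sym 1≈0) 0≉1
  ... | inj₂ 0<1² = <-respʳ (*-identityˡ 1#) 0<1²

  0<2 : 0# < 2#
  0<2 = +-pos 0<1 0<1

  pos⇒≉0 : ∀ {x} → 0# < x → ¬ (x ≈ 0#)
  pos⇒≉0 0<x x≈0 = <-irrefl (≈-sym x≈0) 0<x

  *-cancel-≉0 : ∀ {x y} → ¬ (x ≈ 0#) → x * y ≈ 0# → y ≈ 0#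
  *-cancel-≉0 {x} {y} x≉0 xy≈0 with inverse x x≉0
  ... | z , xz≈1 = begin
    y             ≈⟨ *-identityˡ y ⟨
    1# * y        ≈⟨ *-congʳ xz≈1 ⟨
    x * z * y     ≈⟨ solve 3 (λ x y z → x :* z :* y := z :* (x :* y)) ≈-refl x y z ⟩
    z * (x * y)   ≈⟨ *-congˡ xy≈0 ⟩
    z * 0#        ≈⟨ zeroʳ z ⟩
    0#            ∎

  sum-linear : ∀ {n} a (f g : Vector Carrier n) →
               sum (λ i → a * f i + g i) ≈ a * sum f + sum g
  sum-linear a f g =
    ≈-trans (∑-distrib-+ (λ i → a * f i) g) (+-congʳ (≈-sym (*-distribˡ-sum a f)))

  infix 6 _*_⊹_

  _*_⊹_ : ∀ {n} → Carrier → Vector Carrier n → Vector Carrier n → Vector Carrier n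
  (a * x ⊹ y) i = a * x i + y i

  Zero : ∀ {n} → Vector Carrier n → Set ℓ₁
  Zero x = x ≈ᵛ λ _ → 0#

  dot : ∀ {n} → Vector Carrier n → Vector Carrier n → Carrier
  dot x y = sum (λ i → x i * y i)

  dot-cong : ∀ {n} {x x′ y y′ : Vector Carrier n} →
             x ≈ᵛ x′ → y ≈ᵛ y′ → dot x y ≈ dot x′ y′
  dot-cong x≈x′ y≈y′ = sum-cong-≋ (λ i → *-cong (x≈x′ i) (y≈y′ i))

  dot-comm : ∀ {n} (x y : Vector Carrier n) → dot x y ≈ dot y x
  dot-comm x y = sum-cong-≋ (λ i → *-comm (x i) (y i))

  dot-linearʳ : ∀ {n} (x : Vector Carrier n) a y z →
                dot x (a * y ⊹ z) ≈ a * dot x y + dot x z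
  dot-linearʳ x a y z = ≈-trans
    (sum-cong-≋ (λ i → solve 4 (λ a x y z → x :* (a :* y :+ z) := a :* (x :* y) :+ x :* z)
                             ≈-refl a (x i) (y i) (z i)))
    (sum-linear a (λ i → x i * y i) (λ i → x i * z i))

  dot-linearˡ : ∀ {n} a (x y z : Vector Carrier n) →
                dot (a * x ⊹ y) z ≈ a * dot x z + dot y z
  dot-linearˡ a x y z = begin
    dot (a * x ⊹ y) z        ≈⟨ dot-comm (a * x ⊹ y) z ⟩
    dot z (a * x ⊹ y)        ≈⟨ dot-linearʳ z a x y ⟩
    a * dot z x + dot z y    ≈⟨ +-cong (*-congˡ (dot-comm z x)) (dot-comm z y) ⟩
    a * dot x z + dot y z    ∎

  dot-+ʳ : ∀ {n} (x y z : Vector Carrier n) → dot x (λ i → y i + z i) ≈ dot x y + dot x z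
  dot-+ʳ x y z = ≈-trans (sum-cong-≋ (λ i → distribˡ (x i) (y i) (z i)))
                         (∑-distrib-+ (λ i → x i * y i) (λ i → x i * z i))

  dot-+ˡ : ∀ {n} (x y z : Vector Carrier n) → dot (λ i → x i + y i) z ≈ dot x z + dot y z
  dot-+ˡ x y z = ≈-trans (sum-cong-≋ (λ i → distribʳ (z i) (x i) (y i)))
                         (∑-distrib-+ (λ i → x i * z i) (λ i → y i * z i))

  dot-square : ∀ {n} a (x y : Vector Carrier n) →
    dot (a * x ⊹ y) (a * x ⊹ y) ≈ a * (a * dot x x) + (a * dot x y + a * dot x y) + dot y y
  dot-square a x y = begin
    dot (a * x ⊹ y) (a * x ⊹ y)
      ≈⟨ dot-linearˡ a x y (a * x ⊹ y) ⟩
    a * dot x (a * x ⊹ y) + dot y (a * x ⊹ y)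
      ≈⟨ +-cong (*-congˡ (dot-linearʳ x a x y)) (≈-trans (dot-linearʳ y a x y) (+-congʳ (*-congˡ (dot-comm y x)))) ⟩
    a * (a * dot x x + dot x y) + (a * dot x y + dot y y)
      ≈⟨ solve 4 (λ a p q r → a :* (a :* p :+ q) :+ (a :* q :+ r) := a :* (a :* p) :+ (a :* q :+ a :* q) :+ r)
           ≈-refl a (dot x x) (dot x y) (dot y y) ⟩
    a * (a * dot x x) + (a * dot x y + a * dot x y) + dot y y ∎

  dot-zeroʳ : ∀ {n} (x : Vector Carrier n) {y} → Zero y → dot x y ≈ 0#
  dot-zeroʳ x y≈0 = sum-zero (λ i → ≈-trans (*-congˡ (y≈0 i)) (zeroʳ (x i)))

  dot-scaleʳ : ∀ {n} a (x y : Vector Carrier n) → dot x (λ i → a * y i) ≈ a * dot x y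
  dot-scaleʳ a x y = ≈-trans
    (sum-cong-≋ (λ i → solve 3 (λ a x y → x :* (a :* y) := a :* (x :* y)) ≈-refl a (x i) (y i)))
    (≈-sym (*-distribˡ-sum a (λ i → x i * y i)))

  zero⊎dot-pos : ∀ {n} (x : Vector Carrier n) → Zero x ⊎ 0# < dot x x
  zero⊎dot-pos {zero}  x = inj₁ λ ()
  zero⊎dot-pos {suc n} x with zero⊎square-pos (x zero) | zero⊎dot-pos (x ∘ suc)
  ... | inj₁ x₀≈0 | inj₁ x′≈0 = inj₁ λ { zero → x₀≈0 ; (suc i) → x′≈0 i }
  ... | inj₁ x₀≈0 | inj₂ 0<x′ = inj₂ (<-respʳ
      (≈-trans (≈-sym (+-identityˡ _)) (+-congʳ (≈-sym (≈-trans (*-congˡ x₀≈0) (zeroʳ _))))) 0<x′)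
  ... | inj₂ 0<x₀ | inj₁ x′≈0 = inj₂ (<-respʳ
      (≈-trans (≈-sym (+-identityʳ _)) (+-congˡ (≈-sym (dot-zeroʳ (x ∘ suc) x′≈0)))) 0<x₀)
  ... | inj₂ 0<x₀ | inj₂ 0<x′ = inj₂ (+-pos 0<x₀ 0<x′)

  apply : ∀ {n m} → (Fin n → Fin m → Carrier) → Vector Carrier m → Vector Carrier n
  apply B x v = sum (λ e → B v e * x e)

  applyᵀ : ∀ {n m} → (Fin n → Fin m → Carrier) → Vector Carrier n → Vector Carrier m
  applyᵀ B = apply (λ e v → B v e)

  apply-cong : ∀ {n m} (B : Fin n → Fin m → Carrier) {x y} → x ≈ᵛ y → apply B x ≈ᵛ apply B y
  apply-cong B x≈y v = sum-cong-≋ (λ e → *-congˡ (x≈y e))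

  apply-linear : ∀ {n m} (B : Fin n → Fin m → Carrier) a x y →
                 apply B (a * x ⊹ y) ≈ᵛ a * apply B x ⊹ apply B y
  apply-linear B a x y v = dot-linearʳ (B v) a x y

  apply-zero : ∀ {n m} (B : Fin n → Fin m → Carrier) {x} → Zero x → Zero (apply B x)
  apply-zero B x≈0 v = dot-zeroʳ (B v) x≈0

  apply-scale : ∀ {n m} (B : Fin n → Fin m → Carrier) a x →
                apply B (λ e → a * x e) ≈ᵛ (λ v → a * apply B x v)
  apply-scale B a x v = dot-scaleʳ a (B v) x

  -- Besides moving B across the pairing, this serves as associativity of matrix products, as in
  -- (BᵀB)x = Bᵀ(Bx).
  dot-adjoint : ∀ {n m} (B : Fin n → Fin m → Carrier) x y →
                dot y (apply B x) ≈ dot (applyᵀ B y) x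
  dot-adjoint B x y = begin
    sum (λ v → y v * sum (λ e → B v e * x e))
      ≈⟨ sum-cong-≋ (λ v → *-distribˡ-sum (y v) (λ e → B v e * x e)) ⟩
    sum (λ v → sum (λ e → y v * (B v e * x e)))
      ≈⟨ ∑-comm (λ v e → y v * (B v e * x e)) ⟩
    sum (λ e → sum (λ v → y v * (B v e * x e)))
      ≈⟨ sum-cong-≋ (λ e → sum-cong-≋ (λ v →
           solve 3 (λ y b x → y :* (b :* x) := (b :* y) :* x) ≈-refl (y v) (B v e) (x e))) ⟩
    sum (λ e → sum (λ v → (B v e * y v) * x e))
      ≈⟨ sum-cong-≋ (λ e → *-distribʳ-sum (x e) (λ v → B v e * y v)) ⟨
    sum (λ e → sum (λ v → B v e * y v) * x e) ∎

  record LinearMap (k m : ℕ) : Set (c ⊔ ℓ₁) where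
    field
      map    : Vector Carrier k → Vector Carrier m
      cong   : ∀ {x y} → x ≈ᵛ y → map x ≈ᵛ map y
      linear : ∀ a x y → map (a * x ⊹ y) ≈ᵛ a * map x ⊹ map y

    -- If x vanishes then 1x + x = x, so `linear` gives f(x) + f(x) = f(x).
    map-zero : ∀ {x} → Zero x → Zero (map x)
    map-zero {x} x≈0 i = x+x≈x⇒x≈0 _ (begin
      map x i + map x i         ≈⟨ +-congʳ (*-identityˡ _) ⟨
      1# * map x i + map x i    ≈⟨ linear 1# x x i ⟨
      map (1# * x ⊹ x) i        ≈⟨ cong (λ j → ≈-trans (+-congʳ (*-identityˡ _))
                                     (≈-trans (+-cong (x≈0 j) ≈-refl) (+-identityˡ _))) i ⟩
      map x i                   ∎)

  open LinearMap

  infixr 9 _∘ˡ_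

  _∘ˡ_ : ∀ {k l m} → LinearMap l m → LinearMap k l → LinearMap k m
  f ∘ˡ g = record
    { map    = map f ∘ map g
    ; cong   = cong f ∘ cong g
    ; linear = λ a x y i → ≈-trans (cong f (linear g a x y) i) (linear f a _ _ i)
    }

  0ˡ : ∀ {k m} → LinearMap k m
  0ˡ = record
    { map    = λ _ _ → 0#
    ; cong   = λ _ _ → ≈-refl
    ; linear = λ a _ _ _ → ≈-sym (≈-trans (+-identityʳ _) (zeroʳ a))
    }

  -- One step of Gaussian elimination: a single linear equation, written as a map to dimension 1,
  -- costs at most one dimension. The solutions are given through an injective parametrisation.
  kernel : ∀ {k} (f : LinearMap (suc k) 1) →
           ∃[ ι ] (∀ x → map f (map {k} ι x) zero ≈ 0#) × (∀ x → Zero (map ι x) → Zero x)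
  kernel {zero} f =
    0ˡ , (λ _ → map-zero f (λ _ → ≈-refl) zero) , λ _ _ ()
  kernel {suc k} f = embedding
    where
    e₀ : Vector Carrier (suc (suc k))
    e₀ zero    = 1#
    e₀ (suc _) = 0#

    p = map f e₀ zero

    extend : LinearMap (suc k) (suc (suc k))
    extend = record
      { map = λ { x zero → 0# ; x (suc i) → x i }
      ; cong = λ { x≈y zero → ≈-refl ; x≈y (suc i) → x≈y i }
      ; linear = λ { a x y zero → ≈-sym (≈-trans (+-identityʳ _) (zeroʳ a))
                   ; a x y (suc i) → ≈-refl }
      }

    value : ∀ x → map f x zero ≈ x zero * p + map f (map extend (x ∘ suc)) zero
    value x = ≈-trans
      (cong f {y = x zero * e₀ ⊹ map extend (x ∘ suc)}
        (λ { zero → ≈-sym (≈-trans (+-identityʳ _) (*-identityʳ _))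
           ; (suc i) → ≈-sym (≈-trans (+-congʳ (zeroʳ _)) (+-identityˡ _)) }) zero)
      (linear f (x zero) e₀ _ zero)

    embedding : ∃[ ι ] (∀ x → map f (map {suc k} ι x) zero ≈ 0#) × (∀ x → Zero (map ι x) → Zero x)
    embedding with p ≟ 0#
    -- The first coordinate does not occur in the equation: it stays free, and the equation is
    -- solved in the others.
    ... | yes p≈0 with kernel (f ∘ˡ extend)
    ...   | ι , vanishes , injective =
      record
        { map = λ { x zero → x zero ; x (suc i) → map ι (x ∘ suc) i }
        ; cong = λ { x≈y zero → x≈y zero ; x≈y (suc i) → cong ι (x≈y ∘ suc) i }
        ; linear = λ { a x y zero → ≈-refl ; a x y (suc i) → linear ι a (x ∘ suc) (y ∘ suc) i }
        } ,
      (λ x → ≈-trans (value _) (≈-trans (+-cong (≈-trans (*-congˡ p≈0) (zeroʳ _)) (vanishes (x ∘ suc)))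
                                        (+-identityˡ _))) ,
      λ { x ιx≈0 zero → ιx≈0 zero ; x ιx≈0 (suc i) → injective (x ∘ suc) (ιx≈0 ∘ suc) i }
    embedding | no p≉0 with inverse p p≉0
    ... | q , pq≈1 =
      record
        -- With q = 1/p this first coordinate solves x₀ p + g(x) = 0; the other coordinates are
        -- free.
        { map = λ { x zero → - (q * g x) ; x (suc i) → x i }
        ; cong = λ { x≈y zero → -‿cong (*-congˡ (cong f (cong extend x≈y) zero))
                   ; x≈y (suc i) → x≈y i }
        ; linear = λ { a x y zero → ≈-trans
                         (-‿cong (*-congˡ (linear (f ∘ˡ extend) a x y zero)))
                         (solve 4 (λ q a u v → :- (q :* (a :* u :+ v)) :=
                                               a :* (:- (q :* u)) :+ :- (q :* v))
                                ≈-refl q a (g x) (g y))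
                     ; a x y (suc i) → ≈-refl }
        } ,
      (λ x → begin
        map f _ zero                 ≈⟨ value _ ⟩
        - (q * g x) * p + g x
          ≈⟨ solve 3 (λ q g p → :- (q :* g) :* p :+ g := g :- p :* q :* g) ≈-refl q (g x) p ⟩
        g x - p * q * g x            ≈⟨ +-congˡ (-‿cong (*-congʳ pq≈1)) ⟩
        g x - 1# * g x               ≈⟨ +-congˡ (-‿cong (*-identityˡ _)) ⟩
        g x - g x                    ≈⟨ -‿inverseʳ _ ⟩
        0#                           ∎) ,
      λ x ιx≈0 i → ιx≈0 (suc i)
      where
      g : Vector Carrier (suc k) → Carrier
      g x = map f (map extend x) zero

  injective⇒≤ : ∀ {k m} (f : LinearMap k m) → (∀ x → Zero (map f x) → Zero x) → k ≤ m
  injective⇒≤ {zero}          f injective = z≤n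
  injective⇒≤ {suc k} {zero}  f injective =
    contradiction (≈-sym (injective (λ _ → 1#) (λ ()) zero)) 0≉1
  injective⇒≤ {suc k} {suc m} f injective
    with kernel (record { map    = λ x _ → map f x zero
                        ; cong   = λ x≈y _ → cong f x≈y zero
                        ; linear = λ a x y _ → linear f a x y zero })
  ... | ι , vanishes , ι-injective = s≤s (injective⇒≤
    (record { map    = λ x i → map f (map ι x) (suc i)
            ; cong   = λ x≈y i → cong f (cong ι x≈y) (suc i)
            ; linear = λ a x y i → linear (f ∘ˡ ι) a x y (suc i) })
    (λ x fιx≈0 → ι-injective x (injective _
      (λ { zero → vanishes x ; (suc i) → fιx≈0 i }))))

  takeˡ : ∀ {k} l → LinearMap (k ℕ.+ l) k
  takeˡ l = record
    { map    = _∘ (_↑ˡ l)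
    ; cong   = _∘ (_↑ˡ l)
    ; linear = λ _ _ _ _ → ≈-refl
    }

  dropˡ : ∀ k {l} → LinearMap (k ℕ.+ l) l
  dropˡ k = record
    { map    = _∘ (k ↑ʳ_)
    ; cong   = _∘ (k ↑ʳ_)
    ; linear = λ _ _ _ _ → ≈-refl
    }

  infixl 6 _⊕ˡ_

  _⊕ˡ_ : ∀ {k l m} → LinearMap k m → LinearMap l m → LinearMap (k ℕ.+ l) m
  _⊕ˡ_ {k} {l} f g = record
    { map    = λ x i → map f (x ∘ (_↑ˡ l)) i + map g (x ∘ (k ↑ʳ_)) i
    ; cong   = λ x≈y i → +-cong (cong f (x≈y ∘ (_↑ˡ l)) i) (cong g (x≈y ∘ (k ↑ʳ_)) i)
    ; linear = λ a x y i → ≈-trans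
        (+-cong (linear f a (x ∘ (_↑ˡ l)) (y ∘ (_↑ˡ l)) i) (linear g a (x ∘ (k ↑ʳ_)) (y ∘ (k ↑ʳ_)) i))
        (solve 5 (λ a u v u′ v′ → (a :* u :+ v) :+ (a :* u′ :+ v′) := a :* (u :+ u′) :+ (v :+ v′))
          ≈-refl a (map f (x ∘ (_↑ˡ l)) i) (map f (y ∘ (_↑ˡ l)) i)
                   (map g (x ∘ (k ↑ʳ_)) i) (map g (y ∘ (k ↑ʳ_)) i))
    }

  -- Definite subspaces and signatures

  -- Either the positive or the negative scalars, to treat both indices of
  -- inertia at once.
  record Cone : Set (c ⊔ ℓ₁ ⊔ lsuc ℓ₂) where
    field
      S     : Pred Carrier ℓ₂
      resp  : ∀ {x y} → x ≈ y → S x → S y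
      add   : ∀ {x y} → S x → S y → S (x + y)
      scale : ∀ {x y} → S x → 0# < y → S (x * y)

    -- P and Q stand for the vanishing of the arguments that produce x and y. This is the argument
    -- that an orthogonal sum of definite forms is definite.
    add-weak : ∀ {p q} {P : Set p} {Q : Set q} {x y} →
               P ⊎ S x → (P → x ≈ 0#) → Q ⊎ S y → (Q → y ≈ 0#) → (P × Q) ⊎ S (x + y)
    add-weak (inj₁ p)  x≈0 (inj₁ q)  y≈0 = inj₁ (p , q)
    add-weak (inj₁ p)  x≈0 (inj₂ Sy) y≈0 =
      inj₂ (resp (≈-sym (≈-trans (+-congʳ (x≈0 p)) (+-identityˡ _))) Sy)
    add-weak (inj₂ Sx) x≈0 (inj₁ q)  y≈0 =
      inj₂ (resp (≈-sym (≈-trans (+-congˡ (y≈0 q)) (+-identityʳ _))) Sx)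
    add-weak (inj₂ Sx) x≈0 (inj₂ Sy) y≈0 = inj₂ (add Sx Sy)

  positive : Cone
  positive = record { S = 0# <_ ; resp = <-respʳ ; add = +-pos ; scale = *-pos }

  negative : Cone
  negative = record
    { S     = _< 0#
    ; resp  = <-respˡ
    ; add   = λ {x} {y} x<0 y<0 → <-trans (<-respʳ (+-identityˡ y) (+-monoˡ-< y x<0)) y<0
    ; scale = λ {x} {y} x<0 0<y → pos-neg
        (<-respʳ (solve 2 (λ x y → (:- x) :* y := :- (x :* y)) ≈-refl x y)
                 (*-pos (neg-pos x<0) 0<y))
    }

  form : ∀ {m} → Matrix m → Vector Carrier m → Carrier
  form M x = dot x (M ·ᵛ x)

  form-cong : ∀ {m} (M : Matrix m) {x y} → x ≈ᵛ y → form M x ≈ form M y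
  form-cong M x≈y = dot-cong x≈y (apply-cong M x≈y)

  form-zero : ∀ {m} (M : Matrix m) {x} → Zero x → form M x ≈ 0#
  form-zero M {x} x≈0 = dot-zeroʳ x (apply-zero M x≈0)

  form-neg : ∀ {m} (M : Matrix m) x → form M (λ i → - x i) ≈ form M x
  form-neg M x = sum-cong-≋ (λ i → ≈-trans
    (*-congˡ (≈-trans (apply-cong M (λ j → neg≈-1* (x j)) i)
              (≈-trans (apply-scale M (- 1#) x i) (≈-sym (neg≈-1* _)))))
    (solve 2 (λ x y → :- x :* :- y := x :* y) ≈-refl (x i) ((M ·ᵛ x) i)))
    where
    neg≈-1* : ∀ x → - x ≈ - 1# * x
    neg≈-1* x = ≈-trans (-‿cong (≈-sym (*-identityˡ x)))
      (solve 2 (λ o x → :- (o :* x) := :- o :* x) ≈-refl 1# x)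

  -- The alternative concerns the coefficient vector x and not its image, so for `positive` and
  -- `negative`, which do not contain 0, it includes injectivity of f.
  Definite : Cone → ∀ {k m} → Matrix m → LinearMap k m → Set _
  Definite C M f = ∀ x → Zero x ⊎ Cone.S C (form M (map f x))

  -- If f(y) + g(z) = 0 then f(y) = -g(z), and the form, being even, takes the same value on f(y)
  -- and g(z). That value cannot be positive and negative, so y and z vanish and the combined map is
  -- injective.
  pos+neg≤ : ∀ {k l m} (M : Matrix m) (f : LinearMap k m) (g : LinearMap l m) →
             Definite positive M f → Definite negative M g → k ℕ.+ l ≤ m
  pos+neg≤ {k} {l} M f g f-pos g-neg = injective⇒≤ (f ⊕ˡ g) injective
    where
    injective : ∀ x → Zero (map (f ⊕ˡ g) x) → Zero x
    injective x fx+gx≈0 = ↑-elim l (λ i → x i ≈ 0#) (proj₁ zeros) (proj₂ zeros)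
      where
      y = x ∘ (_↑ˡ l)
      z = x ∘ (k ↑ʳ_)

      same-form : form M (map f y) ≈ form M (map g z)
      same-form = ≈-trans
        (form-cong M (λ i → +-inverseˡ-unique _ _ (fx+gx≈0 i)))
        (form-neg M (map g z))

      zeros : Zero y × Zero z
      zeros with f-pos y | g-neg z
      ... | inj₁ y≈0 | inj₁ z≈0 = y≈0 , z≈0
      ... | inj₁ y≈0 | inj₂ neg = contradiction neg
              (<-irrefl (≈-trans (≈-sym same-form) (form-zero M (map-zero f y≈0))))
      ... | inj₂ pos | inj₁ z≈0 = contradiction pos
              (<-irrefl (≈-sym (≈-trans same-form (form-zero M (map-zero g z≈0)))))
      ... | inj₂ pos | inj₂ neg = contradiction neg (asym (<-respʳ same-form pos))

  combination-map : ∀ {k m} → (Fin k → Vector Carrier m) → LinearMap k m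
  combination-map b = record
    { map    = λ a → combination a b
    ; cong   = λ x≈y i → sum-cong-≋ (λ j → *-congʳ (x≈y j))
    ; linear = λ a x y i → dot-linearˡ a x y (λ j → b j i)
    }

  #pos #neg : ∀ {m} {M : Matrix m} → Spectrum M → ℕ
  #pos σ = count (λ i → 0# <? Spectrum.eigenvalue σ i)
  #neg σ = count (λ i → Spectrum.eigenvalue σ i <? 0#)

  -- Definite subspaces from eigenvectors of a symmetric matrix

  module _ {m} (M : Matrix m) (M-sym : ∀ i j → M i j ≈ M j i) where

    form-comm : ∀ x y → dot x (M ·ᵛ y) ≈ dot y (M ·ᵛ x)
    form-comm x y = begin
      dot x (M ·ᵛ y)        ≈⟨ dot-adjoint M y x ⟩
      dot (applyᵀ M x) y    ≈⟨ dot-comm (applyᵀ M x) y ⟩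
      dot y (applyᵀ M x)    ≈⟨ dot-cong {x = y} (λ _ → ≈-refl) (λ i → sum-cong-≋ (λ j → *-congʳ (M-sym j i))) ⟩
      dot y (M ·ᵛ x)        ∎

    form-+ : ∀ x y → dot y (M ·ᵛ x) ≈ 0# →
             form M (λ i → x i + y i) ≈ form M x + form M y
    form-+ x y yMx≈0 = begin
      dot (λ i → x i + y i) (M ·ᵛ (λ i → x i + y i))
        ≈⟨ dot-cong {x = λ i → x i + y i} (λ _ → ≈-refl) (λ i → dot-+ʳ (M i) x y) ⟩
      dot (λ i → x i + y i) (λ i → (M ·ᵛ x) i + (M ·ᵛ y) i)
        ≈⟨ dot-+ˡ x y _ ⟩
      dot x (λ i → (M ·ᵛ x) i + (M ·ᵛ y) i) + dot y (λ i → (M ·ᵛ x) i + (M ·ᵛ y) i)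
        ≈⟨ +-cong (dot-+ʳ x (M ·ᵛ x) (M ·ᵛ y)) (dot-+ʳ y (M ·ᵛ x) (M ·ᵛ y)) ⟩
      (form M x + dot x (M ·ᵛ y)) + (dot y (M ·ᵛ x) + form M y)
        ≈⟨ +-cong (≈-trans (+-congˡ (≈-trans (form-comm x y) yMx≈0)) (+-identityʳ _))
                  (≈-trans (+-congʳ yMx≈0) (+-identityˡ _)) ⟩
      form M x + form M y ∎

    -- Symmetry gives a⟨x,y⟩ = b⟨x,y⟩, and the nonzero factor a - b cancels.
    eigen-orthogonal : ∀ {a b x y} → ¬ (a ≈ b) → Eigenspace M a x → Eigenspace M b y →
                       dot x y ≈ 0#
    eigen-orthogonal {a} {b} {x} {y} a≉b Mx≈ax My≈by =
      *-cancel-≉0 (λ a-b≈0 → a≉b (x∙y⁻¹≈ε⇒x≈y a b a-b≈0)) (begin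
        (a - b) * dot x y           ≈⟨ solve 3 (λ a b d → (a :- b) :* d := a :* d :- b :* d) ≈-refl a b (dot x y) ⟩
        a * dot x y - b * dot x y   ≈⟨ x≈y⇒x∙y⁻¹≈ε (begin
          a * dot x y               ≈⟨ *-congˡ (dot-comm x y) ⟩
          a * dot y x               ≈⟨ dot-scaleʳ a y x ⟨
          dot y (λ i → a * x i)     ≈⟨ dot-cong {x = y} (λ _ → ≈-refl) Mx≈ax ⟨
          dot y (M ·ᵛ x)            ≈⟨ form-comm y x ⟩
          dot x (M ·ᵛ y)            ≈⟨ dot-cong {x = x} (λ _ → ≈-refl) My≈by ⟩
          dot x (λ i → b * y i)     ≈⟨ dot-scaleʳ b x y ⟩
          b * dot x y               ∎) ⟩
        0#                          ∎)

    combination-eigen : ∀ {k e} (b : Fin k → Vector Carrier m) → (∀ j → Eigenspace M e (b j)) →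
                        ∀ a → Eigenspace M e (combination a b)
    combination-eigen {e = e} b Mb≈eb a i = begin
      dot (M i) (combination a b)     ≈⟨ dot-cong {x = M i} (λ _ → ≈-refl) (λ j → sum-cong-≋ (λ l → *-comm (a l) (b l j))) ⟩
      dot (M i) (applyᵀ b a)         ≈⟨ dot-comm (M i) (applyᵀ b a) ⟩
      dot (applyᵀ b a) (M i)         ≈⟨ dot-adjoint b (M i) a ⟨
      dot a (apply b (M i))
        ≈⟨ sum-cong-≋ (λ l → *-congˡ (≈-trans (dot-comm (b l) (M i)) (Mb≈eb l i))) ⟩
      sum (λ l → a l * (e * b l i))  ≈⟨ dot-scaleʳ e a (λ l → b l i) ⟩
      e * combination a b i          ∎


    module _ (σ : Spectrum M) (C : Cone) where

      open Spectrum σ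
      open Cone C

      -- `family` parametrises the sum of the eigenspaces whose eigenvalues sit at positions in R.
      -- The field `orthogonal` is the induction invariant that allows the eigenspace of a further
      -- eigenvalue to be adjoined.
      record Family {r} (R : Pred (Fin m) r) (k : ℕ) : Set (c ⊔ ℓ₁ ⊔ ℓ₂ ⊔ r) where
        field
          family     : LinearMap k m
          orthogonal : ∀ {e y} → Eigenspace M e y → (∀ j → R j → ¬ (eigenvalue j ≈ e)) →
                       ∀ x → dot y (map family x) ≈ 0#
          definite   : Definite C M family

      -- Each round removes the whole class of one eigenvalue e from R and adjoins a basis of its
      -- eigenspace. There the form is e⟨x,x⟩ with e in the cone, and it is orthogonal to the rest,
      -- so definiteness is preserved. N bounds the number of rounds.
      families : ∀ {r} N {R : Pred (Fin m) r} (R? : Decidable R) →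
                 (∀ {i j} → R i → eigenvalue j ≈ eigenvalue i → R j) →
                 (∀ j → R j → S (eigenvalue j)) → count R? ≤ N → Family R (count R?)
      families N {R} R? closed R⊆S count≤N with count≡0⊎∃ R?
      ... | inj₁ count≡0 = ≡.subst (Family R) (≡.sym count≡0) (record
        { family     = 0ˡ
        ; orthogonal = λ {e} {y} _ _ _ → dot-zeroʳ y (λ _ → ≈-refl)
        ; definite   = λ _ → inj₁ λ ()
        })
      families N {R} R? closed R⊆S count≤N | inj₂ (i₀ , Ri₀) =
        ≡.subst (Family R) (≡.sym count-split) (step N count≤N)
        where
        e = eigenvalue i₀

        Same? : Decidable (λ j → eigenvalue j ≈ e)
        Same? j = eigenvalue j ≟ e

        Rest? : Decidable (λ j → R j × ¬ (eigenvalue j ≈ e))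
        Rest? j = R? j ×-dec ¬? (Same? j)

        k = count Same?
        l = count Rest?

        -- The eigenspace of e has dimension k, counted over all positions; closedness of R puts
        -- every one of them in R.
        count-split : count R? ≡ k ℕ.+ l
        count-split = count-partition R? Same? Rest?
          (λ j Rj → case-same j Rj) (λ j same → closed Ri₀ same) (λ j → proj₁)
          (λ j same rest → proj₂ rest same)
          where
          case-same : ∀ j → R j → eigenvalue j ≈ e ⊎ (R j × ¬ (eigenvalue j ≈ e))
          case-same j Rj with Same? j
          ... | yes same = inj₁ same
          ... | no  diff = inj₂ (Rj , diff)

        step : ∀ N → count R? ≤ N → Family R (k ℕ.+ l)
        step zero    count≤0 = contradiction (count>0 R? Ri₀) (ℕₚ.≤⇒≯ count≤0)
        step (suc N) count≤N = record
          { family     = f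
          ; orthogonal = λ {e′} {y} My≈e′y avoids x → ≈-trans (dot-+ʳ y (map g (x ∘ (_↑ˡ l))) (map g′ (x ∘ (k ↑ʳ_))))
              (≈-trans (+-cong (eigen-orthogonal (λ e′≈e → avoids i₀ Ri₀ (≈-sym e′≈e)) My≈e′y (g-eigen _))
                               (orthogonal rest My≈e′y (λ j Rj → avoids j (proj₁ Rj)) _))
                       (+-identityˡ 0#))
          ; definite   = f-definite
          }
          where
          rest : Family (λ j → R j × ¬ (eigenvalue j ≈ e)) l
          rest = families N Rest?
            (λ (Ri , i≉e) j≈i → closed Ri j≈i , λ j≈e → i≉e (≈-trans (≈-sym j≈i) j≈e))
            (λ j Rj → R⊆S j (proj₁ Rj))
            -- The removed class contains i₀, so strictly fewer positions remain.
            (ℕₚ.≤-pred (ℕₚ.≤-trans (ℕₚ.+-monoˡ-≤ l (count>0 Same? {i₀} ≈-refl))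
                                   (ℕₚ.≤-trans (ℕₚ.≤-reflexive (≡.sym count-split)) count≤N)))
          open Family
          open Basis (multiplicity e)

          g : LinearMap k m
          g = combination-map basis

          g′ : LinearMap l m
          g′ = family rest

          f : LinearMap (k ℕ.+ l) m
          f = g ⊕ˡ g′

          g-eigen : ∀ x → Eigenspace M e (map g x)
          g-eigen = combination-eigen basis inSubspace

          f-definite : Definite C M f
          f-definite x = result
            where
            y = x ∘ (_↑ˡ l)
            z = x ∘ (k ↑ʳ_)

            form-g : form M (map g y) ≈ e * dot (map g y) (map g y)
            form-g = ≈-trans (dot-cong {x = map g y} (λ _ → ≈-refl) (g-eigen y)) (dot-scaleʳ e (map g y) (map g y))

            form-f : form M (map f x) ≈ e * dot (map g y) (map g y) + form M (map g′ z)
            form-f = ≈-trans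
              (form-+ (map g y) (map g′ z) (begin
                dot (map g′ z) (M ·ᵛ map g y)          ≈⟨ dot-cong {x = map g′ z} (λ _ → ≈-refl) (g-eigen y) ⟩
                dot (map g′ z) (λ i → e * map g y i)   ≈⟨ dot-scaleʳ e (map g′ z) (map g y) ⟩
                e * dot (map g′ z) (map g y)
                  ≈⟨ *-congˡ (≈-trans (dot-comm (map g′ z) (map g y)) (orthogonal rest (g-eigen y) (λ j → proj₂) z)) ⟩
                e * 0#                                 ≈⟨ zeroʳ e ⟩
                0#                                     ∎))
              (+-congʳ form-g)

            result : Zero x ⊎ S (form M (map f x))
            result with add-weak
              (Sum.map₂ (scale (R⊆S i₀ Ri₀)) (zero⊎dot-pos (map g y)))
              (λ gy≈0 → ≈-trans (*-congˡ (dot-zeroʳ (map g y) gy≈0)) (zeroʳ e))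
              (definite rest z)
              (λ z≈0 → form-zero M (map-zero g′ z≈0))
            -- Only the combination of basis vectors is known to vanish; independence passes to its
            -- coefficients.
            ... | inj₁ (gy≈0 , z≈0) = inj₁ (↑-elim l (λ i → x i ≈ 0#) (independent y gy≈0) z≈0)
            ... | inj₂ Sfx          = inj₂ (resp (≈-sym form-f) Sfx)

    module _ (σ : Spectrum M) where

      open Spectrum σ

      positive-map : ∃[ f ] Definite positive {#pos σ} M f
      positive-map = Family.family fam , Family.definite fam
        where fam = families σ positive _ (λ i → 0# <? eigenvalue i)
                      (λ p eq → <-respʳ (≈-sym eq) p) (λ _ p → p) ℕₚ.≤-refl

      negative-map : ∃[ f ] Definite negative {#neg σ} M f
      negative-map = Family.family fam , Family.definite fam
        where fam = families σ negative _ (λ i → eigenvalue i <? 0#)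
                      (λ p eq → <-respˡ (≈-sym eq) p) (λ _ p → p) ℕₚ.≤-refl

      -- A trivial kernel leaves no room for the eigenvalue 0, so every position is positive or
      -- negative.
      pos+neg≡ : (∀ x → Zero (M ·ᵛ x) → Zero x) → #pos σ ℕ.+ #neg σ ≡ m
      pos+neg≡ regular = ≡.trans (≡.sym (count-partition All? (λ i → 0# <? eigenvalue i) (λ i → eigenvalue i <? 0#)
          (λ i _ → sign i) (λ _ _ → tt) (λ _ _ → tt) (λ i → asym)))
          (count-all All? (λ _ → tt))
        where
        All? : Decidable {A = Fin m} (λ _ → ⊤ {ℓ₂})
        All? _ = yes tt

        nonzero : ∀ i → ¬ (eigenvalue i ≈ 0#)
        nonzero i i≈0 = go (count (λ j → eigenvalue j ≟ 0#)) (count>0 (λ j → eigenvalue j ≟ 0#) i≈0) (multiplicity 0#)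
          where
          -- The dimension is generalised to k so that matching can expose a first basis vector. All
          -- basis vectors lie in the trivial kernel, so the combination with coefficients 1
          -- vanishes, against independence.
          go : ∀ k → 0 ℕ.< k → ¬ Basis (Eigenspace M 0#) k
          go (suc k) _ B = 0≉1 (≈-sym (independent (λ _ → 1#) combination≈0 zero))
            where
            open Basis B
            basis≈0 : ∀ j → Zero (basis j)
            basis≈0 j = regular (basis j) (λ i → ≈-trans (inSubspace j i) (zeroˡ _))
            combination≈0 : Zero (combination (λ _ → 1#) basis)
            combination≈0 i = sum-zero (λ j → ≈-trans (*-congˡ (basis≈0 j i)) (zeroʳ 1#))

        sign : ∀ i → 0# < eigenvalue i ⊎ eigenvalue i < 0#
        sign i with compare (eigenvalue i) 0#
        ... | tri< neg _ _ = inj₂ neg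
        ... | tri≈ _ eq _  = contradiction eq (nonzero i)
        ... | tri> _ _ pos = inj₁ pos

  -- Incidence matrices

  δ : ∀ {n} → Fin n → Fin n → Carrier
  δ = scalar 1#

  δ-same : ∀ {n} {i j : Fin n} → i ≡ j → δ i j ≈ 1#
  δ-same {i = i} {j} = when-yes (i ≟ᶠ j)

  δ-diff : ∀ {n} {i j : Fin n} → i ≢ j → δ i j ≈ 0#
  δ-diff {i = i} {j} = when-no (i ≟ᶠ j)

  diagonal-apply : ∀ {n} (d : Vector Carrier n) x → diagonal d ·ᵛ x ≈ᵛ (λ i → d i * x i)
  diagonal-apply d x i = ≈-trans
    (sum-only (λ j → diagonal d i j * x j) i
      (λ j j≢i → ≈-trans (*-congʳ (when-no (i ≟ᶠ j) (j≢i ∘ ≡.sym))) (zeroˡ _)))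
    (*-congʳ (when-yes (i ≟ᶠ i) ≡.refl))

  sum-δ : ∀ {n} (a : Fin n) (f : Vector Carrier n) → sum (λ i → δ i a * f i) ≈ f a
  sum-δ a f = ≈-trans
    (sum-only (λ i → δ i a * f i) a (λ i i≢a → ≈-trans (*-congʳ (δ-diff i≢a)) (zeroˡ _)))
    (≈-trans (*-congʳ (δ-same {i = a} ≡.refl)) (*-identityˡ _))

  -- A column of the unoriented incidence matrix, defined for every pair of vertices so that
  -- `edge-sum` and `join-edge-sum` apply.
  inc : ∀ {n} → Fin n → Fin n × Fin n → Carrier
  inc v (a , b) = δ v a + δ v b

  sum-inc : ∀ {n} (e : Fin n × Fin n) (f : Vector Carrier n) → sum (λ v → inc v e * f v) ≈ f (proj₁ e) + f (proj₂ e)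
  sum-inc (a , b) f = begin
    sum (λ v → (δ v a + δ v b) * f v)                    ≈⟨ sum-cong-≋ (λ v → distribʳ (f v) (δ v a) (δ v b)) ⟩
    sum (λ v → δ v a * f v + δ v b * f v)                ≈⟨ ∑-distrib-+ (λ v → δ v a * f v) (λ v → δ v b * f v) ⟩
    sum (λ v → δ v a * f v) + sum (λ v → δ v b * f v)    ≈⟨ +-cong (sum-δ a f) (sum-δ b f) ⟩
    f a + f b                                            ∎

  incidence : ∀ {n} (G : Graph n) → Fin n → Fin (size G) → Carrier
  incidence G v i = inc v (edge G i)

  -- Each entry of BᵀB counts coincidences of endpoints: two on the diagonal, and at most one for
  -- distinct edges of a simple graph.
  gram-lineGraph : ∀ {n} (G : Graph n) i j →
    sum (λ v → incidence G v i * incidence G v j) ≈ adjacency (lineGraph G) i j + scalar 2# i j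
  gram-lineGraph G i j = ≈-trans (sum-inc (edge G i) (λ v → incidence G v j)) entry
    where
    L = lineGraph G
    a = proj₁ (edge G i)
    b = proj₂ (edge G i)
    c′ = proj₁ (edge G j)
    d = proj₂ (edge G j)

    a<b : a <ᶠ b
    a<b = edge-< G i
    c<d : c′ <ᶠ d
    c<d = edge-< G j

    irr : ∀ {n} {x y : Fin n} → x <ᶠ y → x ≢ y
    irr x<y x≡y = <ᶠ-irrefl x≡y x<y

    add₄ : ∀ {w x y z w′ x′ y′ z′} → w ≈ w′ → x ≈ x′ → y ≈ y′ → z ≈ z′ →
           (w + x) + (y + z) ≈ (w′ + x′) + (y′ + z′)
    add₄ p q r s = +-cong (+-cong p q) (+-cong r s)

    entry : (δ a c′ + δ a d) + (δ b c′ + δ b d) ≈ adjacency L i j + scalar 2# i j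
    entry with i ≟ᶠ j
    ... | yes ≡.refl = begin
      (δ a a + δ a b) + (δ b a + δ b b)
        ≈⟨ add₄ (δ-same {i = a} ≡.refl) (δ-diff (irr a<b)) (δ-diff (irr a<b ∘ ≡.sym)) (δ-same {i = b} ≡.refl) ⟩
      (1# + 0#) + (0# + 1#)  ≈⟨ +-cong (+-identityʳ 1#) (+-identityˡ 1#) ⟩
      2#                     ≈⟨ +-identityˡ 2# ⟨
      0# + 2#                ∎
    ... | no i≢j = ≈-trans off (≈-sym (+-identityʳ _))
      where
      distinct : a ≡ c′ → b ≢ d
      distinct a≡c b≡d = i≢j (edge-injective G (≡.cong₂ _,_ a≡c b≡d))

      off : (δ a c′ + δ a d) + (δ b c′ + δ b d) ≈ when (shareEndpoint? (edge G i) (edge G j)) 1#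
      off with a ≟ᶠ c′ | a ≟ᶠ d | b ≟ᶠ c′ | b ≟ᶠ d
      ... | yes a≡c | yes a≡d | _       | _       = contradiction (≡.trans (≡.sym a≡c) a≡d) (irr c<d)
      ... | yes a≡c | _       | yes b≡c | _       = contradiction (≡.trans a≡c (≡.sym b≡c)) (irr a<b)
      ... | yes a≡c | _       | _       | yes b≡d = contradiction b≡d (distinct a≡c)
      -- The same edge read backwards: impossible, because every edge is listed with its smaller
      -- endpoint first.
      ... | _       | yes a≡d | yes b≡c | _       =
        contradiction c<d (<ᶠ-asym (≡.subst₂ _<ᶠ_ a≡d b≡c a<b))
      ... | _       | yes a≡d | _       | yes b≡d = contradiction (≡.trans a≡d (≡.sym b≡d)) (irr a<b)
      ... | _       | _       | yes b≡c | yes b≡d = contradiction (≡.trans (≡.sym b≡c) b≡d) (irr c<d)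
      ... | yes _   | no _    | no _    | no _    = ≈-trans (+-cong (+-identityʳ 1#) (+-identityʳ 0#)) (+-identityʳ 1#)
      ... | no _    | yes _   | no _    | no _    = ≈-trans (+-cong (+-identityˡ 1#) (+-identityʳ 0#)) (+-identityʳ 1#)
      ... | no _    | no _    | yes _   | no _    = ≈-trans (+-cong (+-identityʳ 0#) (+-identityʳ 1#)) (+-identityˡ 1#)
      ... | no _    | no _    | no _    | yes _   = ≈-trans (+-cong (+-identityʳ 0#) (+-identityˡ 1#)) (+-identityˡ 1#)
      ... | no _    | no _    | no _    | no _    = ≈-trans (+-cong (+-identityʳ 0#) (+-identityʳ 0#)) (+-identityʳ 0#)

  when-* : ∀ {p} {P : Set p} (P? : Dec P) x → when P? x ≈ when P? 1# * x
  when-* (yes _) x = ≈-sym (*-identityˡ x)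
  when-* (no _)  x = ≈-sym (zeroˡ x)

  when-+ : ∀ {p} {P : Set p} (P? : Dec P) x y → when P? (x + y) ≈ when P? x + when P? y
  when-+ (yes _) x y = ≈-refl
  when-+ (no _)  x y = ≈-sym (+-identityˡ 0#)

  when-cong : ∀ {p} {P : Set p} (P? : Dec P) {x y} → x ≈ y → when P? x ≈ when P? y
  when-cong (yes _) x≈y = x≈y
  when-cong (no _)  x≈y = ≈-refl

  when-0 : ∀ {p} {P : Set p} (P? : Dec P) {x} → x ≈ 0# → when P? x ≈ 0#
  when-0 (yes _) x≈0 = x≈0
  when-0 (no _)  x≈0 = ≈-refl

  module _ {n} (G : Graph n) where

    private
      B = incidence G

    -- An adjacent pair is listed in exactly one of its two orders, so adding both orders recovers
    -- adjacency.
    orient : ∀ x y t → when (isEdge? G x y) t + when (isEdge? G y x) t ≈ when (adj? G x y) t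
    orient x y t with <ᶠ-cmp x y
    ... | tri< x<y _ y≮x = ≈-trans
      (+-cong (when-⇔ (isEdge? G x y) (adj? G x y) proj₂ (x<y ,_)) (when-no (isEdge? G y x) (y≮x ∘ proj₁)))
      (+-identityʳ _)
    ... | tri> x≮y _ y<x = ≈-trans
      (+-cong (when-no (isEdge? G x y) (x≮y ∘ proj₁))
              (when-⇔ (isEdge? G y x) (adj? G x y) (Graph.sym G ∘ proj₂) (λ a → y<x , Graph.sym G a)))
      (+-identityˡ _)
    ... | tri≈ x≮y x≡y y≮x = ≈-trans
      (+-cong (when-no (isEdge? G x y) (x≮y ∘ proj₁)) (when-no (isEdge? G y x) (y≮x ∘ proj₁)))
      (≈-trans (+-identityʳ 0#) (≈-sym (when-no (adj? G x y) (Graph.irrefl G x≡y))))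

    applyᵀ-incidence : ∀ z i → applyᵀ B z i ≈ z (proj₁ (edge G i)) + z (proj₂ (edge G i))
    applyᵀ-incidence z i = sum-inc (edge G i) z

    -- At x both sides are the sum of z(x) + z(y) over the neighbours y of x: the terms z(y) give A,
    -- and z(x), repeated once per neighbour, gives D.
    incidence-incidenceᵀ : ∀ z → apply B (applyᵀ B z) ≈ᵛ signlessLaplacian G ·ᵛ z
    incidence-incidenceᵀ z x = begin
      sum (λ i → inc x (edge G i) * applyᵀ B z i)
        ≈⟨ sum-cong-≋ (λ i → *-congˡ (applyᵀ-incidence z i)) ⟩
      sum (λ i → inc x (edge G i) * (z (proj₁ (edge G i)) + z (proj₂ (edge G i))))
        ≈⟨ edge-sum G (λ (a , b) → inc x (a , b) * s a b) ⟩
      sum (λ a → sum (λ b → when (isEdge? G a b) ((δ x a + δ x b) * s a b)))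
        ≈⟨ sum-cong-≋ (λ a → ≈-trans
             (sum-cong-≋ (λ b → ≈-trans (when-cong (isEdge? G a b) (distribʳ (s a b) (δ x a) (δ x b)))
                                        (when-+ (isEdge? G a b) (δ x a * s a b) (δ x b * s a b))))
             (∑-distrib-+ (p a) (q a))) ⟩
      sum (λ a → sum (p a) + sum (q a))
        ≈⟨ ∑-distrib-+ (λ a → sum (p a)) (λ a → sum (q a)) ⟩
      sum (λ a → sum (p a)) + sum (λ a → sum (q a))
        -- `δ x a` selects the edges with x as smaller endpoint, `δ x b` those with x as larger
        -- endpoint.
        ≈⟨ +-cong
             (sum-only (λ a → sum (p a)) x (λ a a≢x → sum-zero (λ b →
               when-0 (isEdge? G a b) (≈-trans (*-congʳ (δ-diff (a≢x ∘ ≡.sym))) (zeroˡ _)))))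
             (sum-cong-≋ (λ a → sum-only (q a) x (λ b b≢x →
               when-0 (isEdge? G a b) (≈-trans (*-congʳ (δ-diff (b≢x ∘ ≡.sym))) (zeroˡ _))))) ⟩
      sum (p x) + sum (λ a → q a x)
        ≈⟨ ∑-distrib-+ (p x) (λ a → q a x) ⟨
      sum (λ b → p x b + q b x)
        ≈⟨ sum-cong-≋ (λ b → ≈-trans
             (+-cong (when-cong (isEdge? G x b) (≈-trans (*-congʳ (δ-same {i = x} ≡.refl)) (*-identityˡ _)))
                     (when-cong (isEdge? G b x) (≈-trans (≈-trans (*-congʳ (δ-same {i = x} ≡.refl)) (*-identityˡ _))
                                                         (+-comm (z b) (z x)))))
             (orient x b (s x b))) ⟩
      sum (λ b → when (adj? G x b) (z x + z b))
        ≈⟨ sum-cong-≋ (λ b → ≈-trans (when-* (adj? G x b) (z x + z b)) (distribˡ (A x b) (z x) (z b))) ⟩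
      sum (λ b → A x b * z x + A x b * z b)
        ≈⟨ ∑-distrib-+ (λ b → A x b * z x) (λ b → A x b * z b) ⟩
      sum (λ b → A x b * z x) + sum (λ b → A x b * z b)
        ≈⟨ +-congʳ (*-distribʳ-sum (z x) (A x)) ⟨
      sum (A x) * z x + sum (λ b → A x b * z b)
        ≈⟨ +-comm _ _ ⟩
      sum (λ b → A x b * z b) + sum (A x) * z x
        ≈⟨ +-congˡ (*-congʳ (≈-trans (≈-sym (sum-count (adj? G x) 1#)) (sum-replicate (degree G x)))) ⟩
      sum (λ b → A x b * z b) + D x * z x
        ≈⟨ +-congˡ (diagonal-apply D z x) ⟨
      sum (λ b → A x b * z b) + (diagonal D ·ᵛ z) x
        ≈⟨ ∑-distrib-+ (λ b → A x b * z b) (λ b → diagonal D x b * z b) ⟨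
      sum (λ b → A x b * z b + diagonal D x b * z b)
        ≈⟨ sum-cong-≋ (λ b → distribʳ (z b) (A x b) (diagonal D x b)) ⟨
      (signlessLaplacian G ·ᵛ z) x ∎
      where
      A = adjacency G

      D : Vector Carrier n
      D y = degree G y ×# 1#

      s : Fin n → Fin n → Carrier
      s a b = z a + z b

      p q : Fin n → Fin n → Carrier
      p a b = when (isEdge? G a b) (δ x a * s a b)
      q a b = when (isEdge? G a b) (δ x b * s a b)

    incidenceᵀ-incidence : ∀ x i →
      applyᵀ B (apply B x) i ≈ (adjacency (lineGraph G) ·ᵛ x) i + 2# * x i
    incidenceᵀ-incidence x i = begin
      dot (λ v → B v i) (apply B x)
        ≈⟨ dot-adjoint B x (λ v → B v i) ⟩
      sum (λ j → sum (λ v → B v j * B v i) * x j)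
        ≈⟨ sum-cong-≋ (λ j → *-congʳ (≈-trans (sum-cong-≋ (λ v → *-comm (B v j) (B v i))) (gram-lineGraph G i j))) ⟩
      sum (λ j → (adjacency (lineGraph G) i j + scalar 2# i j) * x j)
        ≈⟨ sum-cong-≋ (λ j → distribʳ (x j) _ _) ⟩
      sum (λ j → adjacency (lineGraph G) i j * x j + scalar 2# i j * x j)
        ≈⟨ ∑-distrib-+ (λ j → adjacency (lineGraph G) i j * x j) (λ j → scalar 2# i j * x j) ⟩
      (adjacency (lineGraph G) ·ᵛ x) i + (scalar 2# ·ᵛ x) i
        ≈⟨ +-congˡ (diagonal-apply (λ _ → 2#) x i) ⟩
      (adjacency (lineGraph G) ·ᵛ x) i + 2# * x i ∎

    -- A(L(G)) = BᵀB - 2I read as quadratic forms. A difference of two norms can be evaluated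
    -- blockwise on a joined graph.
    form-lineGraph : ∀ x →
      form (adjacency (lineGraph G)) x ≈ dot (apply B x) (apply B x) - 2# * dot x x
    form-lineGraph x = x≈z//y _ _ _ (begin
      form (adjacency (lineGraph G)) x + 2# * dot x x
        ≈⟨ +-congˡ (dot-scaleʳ 2# x x) ⟨
      form (adjacency (lineGraph G)) x + dot x (λ i → 2# * x i)
        ≈⟨ dot-+ʳ x _ _ ⟨
      dot x (λ i → (adjacency (lineGraph G) ·ᵛ x) i + 2# * x i)
        ≈⟨ dot-cong {x = x} (λ _ → ≈-refl) (incidenceᵀ-incidence x) ⟨
      dot x (applyᵀ B (apply B x))
        ≈⟨ dot-comm x _ ⟩
      dot (applyᵀ B (apply B x)) x
        ≈⟨ dot-adjoint B x (apply B x) ⟨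
      dot (apply B x) (apply B x) ∎)

    -- If A(L(G))x = 0 then BᵀBx = 2x, hence Q(Bx) = BBᵀBx = 2Bx. So Bx = 0 by hypothesis, and 2x =
    -- BᵀBx = 0.
    lineGraph-regular : (∀ z → signlessLaplacian G ·ᵛ z ≈ᵛ (λ v → 2# * z v) → Zero z) →
                        ∀ x → Zero (adjacency (lineGraph G) ·ᵛ x) → Zero x
    lineGraph-regular regular x Ax≈0 i = *-cancel-≉0 (pos⇒≉0 0<2) (begin
      2# * x i                 ≈⟨ gram i ⟨
      applyᵀ B (apply B x) i   ≈⟨ apply-zero (λ e v → B v e) Bx≈0 i ⟩
      0#                       ∎)
      where
      gram : applyᵀ B (apply B x) ≈ᵛ (λ i → 2# * x i)
      gram i = ≈-trans (incidenceᵀ-incidence x i) (≈-trans (+-congʳ (Ax≈0 i)) (+-identityˡ _))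

      Bx≈0 : Zero (apply B x)
      Bx≈0 = regular (apply B x) (λ v → ≈-trans (≈-sym (incidence-incidenceᵀ (apply B x) v))
        (≈-trans (apply-cong B gram v) (apply-scale B 2# x v)))

    lineGraph-symmetric : ∀ i j → adjacency (lineGraph G) i j ≈ adjacency (lineGraph G) j i
    lineGraph-symmetric i j = when-⇔ (adj? L i j) (adj? L j i) (Graph.sym L) (Graph.sym L)
      where L = lineGraph G

    -- The resolvent of Q(G) at 2 and the elimination of an edge

    module Resolvent (W : Inverse (signlessLaplacian G −ᴹ scalar 2#)) (u : Fin n) where

      open Inverse W

      shifted : ∀ z i → ((signlessLaplacian G −ᴹ scalar 2#) ·ᵛ z) i ≈ (signlessLaplacian G ·ᵛ z) i - 2# * z i
      shifted z i = x≈z//y _ _ _ (begin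
        ((signlessLaplacian G −ᴹ scalar 2#) ·ᵛ z) i + 2# * z i
          ≈⟨ +-congˡ (diagonal-apply (λ _ → 2#) z i) ⟨
        ((signlessLaplacian G −ᴹ scalar 2#) ·ᵛ z) i + (scalar 2# ·ᵛ z) i
          ≈⟨ ∑-distrib-+ (λ j → (signlessLaplacian G −ᴹ scalar 2#) i j * z j) _ ⟨
        sum (λ j → (signlessLaplacian G i j - scalar 2# i j) * z j + scalar 2# i j * z j)
          ≈⟨ sum-cong-≋ (λ j → solve 3 (λ q s z → (q :- s) :* z :+ s :* z := q :* z) ≈-refl
                                       (signlessLaplacian G i j) (scalar 2# i j) (z j)) ⟩
        (signlessLaplacian G ·ᵛ z) i ∎)

      -- The solution of (Q - 2I)g = e_u; its entry at u is φ(u).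
      g : Vector Carrier n
      g i = matrix i u

      g-column : ∀ i → apply B (applyᵀ B g) i ≈ 2# * g i + δ i u
      g-column i = begin
        apply B (applyᵀ B g) i          ≈⟨ incidence-incidenceᵀ g i ⟩
        (signlessLaplacian G ·ᵛ g) i
          ≈⟨ solve 2 (λ q t → q := t :+ (q :- t)) ≈-refl _ (2# * g i) ⟩
        2# * g i + ((signlessLaplacian G ·ᵛ g) i - 2# * g i)
          ≈⟨ +-congˡ (≈-trans (≈-sym (shifted g i)) (inverseʳ i u)) ⟩
        2# * g i + δ i u ∎

      -- The hypothesis says (Q - 2I)z = -s e_u, and the left inverse is applied. This is the
      -- eigenvalue equation of a joined graph seen from one side, where s is the sum of the entries
      -- at the ends of the new edge; s = 0 describes G alone.
      resolve : ∀ z s → (∀ i → apply B (applyᵀ B z) i + δ i u * s ≈ 2# * z i) →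
                ∀ i → z i ≈ - s * g i
      resolve z s eq i = begin
        z i
          ≈⟨ ≈-trans (diagonal-apply (λ _ → 1#) z i) (*-identityˡ (z i)) ⟨
        sum (λ k → δ i k * z k)
          ≈⟨ sum-cong-≋ (λ k → *-congʳ (≈-trans (≈-sym (inverseˡ i k))
               (dot-comm (matrix i) (λ j → N j k)))) ⟩
        sum (λ k → sum (λ j → N j k * matrix i j) * z k)
          ≈⟨ dot-adjoint N z (matrix i) ⟨
        sum (λ j → matrix i j * (N ·ᵛ z) j)
          ≈⟨ sum-cong-≋ (λ j → ≈-trans (*-congˡ (residue j))
               (solve 3 (λ m d s → m :* (:- (d :* s)) := :- s :* (d :* m)) ≈-refl (matrix i j) (δ j u) s)) ⟩
        sum (λ j → - s * (δ j u * matrix i j))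
          ≈⟨ *-distribˡ-sum (- s) (λ j → δ j u * matrix i j) ⟨
        - s * sum (λ j → δ j u * matrix i j)
          ≈⟨ *-congˡ (sum-δ u (matrix i)) ⟩
        - s * g i ∎
        where
        N = signlessLaplacian G −ᴹ scalar 2#

        residue : ∀ j → (N ·ᵛ z) j ≈ - (δ j u * s)
        residue j = begin
          (N ·ᵛ z) j                                   ≈⟨ shifted z j ⟩
          (signlessLaplacian G ·ᵛ z) j - 2# * z j
            ≈⟨ +-cong (≈-sym (incidence-incidenceᵀ z j)) (-‿cong (≈-sym (eq j))) ⟩
          apply B (applyᵀ B z) j - (apply B (applyᵀ B z) j + δ j u * s)
            ≈⟨ solve 2 (λ b d → b :- (b :+ d) := :- d) ≈-refl _ (δ j u * s) ⟩
          - (δ j u * s)                                ∎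

      regular : ∀ z → signlessLaplacian G ·ᵛ z ≈ᵛ (λ v → 2# * z v) → Zero z
      regular z Qz≈2z i = begin
        z i          ≈⟨ resolve z 0# (λ j → ≈-trans (+-congˡ (zeroʳ _)) (≈-trans (+-identityʳ _)
                          (≈-trans (incidence-incidenceᵀ z j) (Qz≈2z j)))) i ⟩
        - 0# * g i   ≈⟨ *-congʳ -0#≈0# ⟩
        0# * g i     ≈⟨ zeroˡ (g i) ⟩
        0#           ∎

      -- Subtracting t Bᵀg from x cancels the coupling of x with a further edge at u
      -- that carries the value t.
      edgePart : Carrier → Vector Carrier (size G) → Vector Carrier (size G)
      edgePart t x = (- t) * applyᵀ B g ⊹ x

      -- The vertex values of `edgePart` together with the further edge. From BBᵀg = 2g + e_u, the
      -- correction contributes -2t g - t e_u, and the further edge contributes t e_u, which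
      -- cancels.
      vertexPart : Carrier → Vector Carrier (size G) → Vector Carrier n
      vertexPart t x = (- (2# * t)) * g ⊹ apply B x

      apply-edgePart : ∀ t x i → apply B (edgePart t x) i + δ i u * t ≈ vertexPart t x i
      apply-edgePart t x i = begin
        apply B (edgePart t x) i + δ i u * t
          ≈⟨ +-congʳ (≈-trans (apply-linear B (- t) (applyᵀ B g) x i) (+-congʳ (*-congˡ (g-column i)))) ⟩
        - t * (2# * g i + δ i u) + apply B x i + δ i u * t
          ≈⟨ solve 5 (λ t l g d b → :- t :* (l :* g :+ d) :+ b :+ d :* t := :- (l :* t) :* g :+ b)
               ≈-refl t 2# (g i) (δ i u) (apply B x i) ⟩
        vertexPart t x i ∎

      -- The mixed terms cancel because ⟨Bᵀg,x⟩ = ⟨g,Bx⟩. The terms in t² leave 4t²⟨g,g⟩ -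
      -- 2t²(2⟨g,g⟩ + φ(u)) = -2t²φ(u), since ⟨Bᵀg,Bᵀg⟩ = ⟨g, 2g + e_u⟩.
      parts-form : ∀ t x →
        dot (vertexPart t x) (vertexPart t x) - 2# * dot (edgePart t x) (edgePart t x) ≈
        form (adjacency (lineGraph G)) x - 2# * (t * t * φ G W u)
      parts-form t x = begin
        dot (vertexPart t x) (vertexPart t x) - 2# * dot (edgePart t x) (edgePart t x)
          ≈⟨ +-cong (dot-square (- (2# * t)) g (apply B x))
                    (-‿cong (*-congˡ (≈-trans (dot-square (- t) (applyᵀ B g) x)
                       (+-congʳ (+-cong (*-congˡ (*-congˡ gram-g)) (+-cong (*-congˡ adj) (*-congˡ adj))))))) ⟩
        (a * (a * P) + (a * R + a * R) + S₀) - 2# * (- t * (- t * (2# * P + φ G W u)) + (- t * R + - t * R) + X)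
          ≈⟨ solve 7 (λ l t P R S₀ φ X →
               (:- (l :* t) :* (:- (l :* t) :* P) :+ (:- (l :* t) :* R :+ :- (l :* t) :* R) :+ S₀)
                 :- l :* (:- t :* (:- t :* (l :* P :+ φ)) :+ (:- t :* R :+ :- t :* R) :+ X)
               := (S₀ :- l :* X) :- l :* (t :* t :* φ)) ≈-refl 2# t P R S₀ (φ G W u) X ⟩
        (S₀ - 2# * X) - 2# * (t * t * φ G W u)
          ≈⟨ +-congʳ (form-lineGraph x) ⟨
        form (adjacency (lineGraph G)) x - 2# * (t * t * φ G W u) ∎
        where
        a = - (2# * t)
        P = dot g g
        R = dot g (apply B x)
        S₀ = dot (apply B x) (apply B x)
        X = dot x x

        adj : dot (applyᵀ B g) x ≈ R
        adj = ≈-sym (dot-adjoint B x g)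

        gram-g : dot (applyᵀ B g) (applyᵀ B g) ≈ 2# * P + φ G W u
        gram-g = begin
          dot (applyᵀ B g) (applyᵀ B g)             ≈⟨ dot-adjoint B (applyᵀ B g) g ⟨
          dot g (apply B (applyᵀ B g))              ≈⟨ dot-cong {x = g} (λ _ → ≈-refl) g-column ⟩
          dot g (2# * g ⊹ λ i → δ i u)              ≈⟨ dot-linearʳ g 2# g (λ i → δ i u) ⟩
          2# * P + dot g (λ i → δ i u)              ≈⟨ +-congˡ (≈-trans (dot-comm g (λ i → δ i u)) (sum-δ u g)) ⟩
          2# * P + φ G W u                          ∎

    -- Pairing with it extends a vector indexed by edge positions to all pairs of vertices, with
    -- value 0 off the listed edges, and visibly linearly in that vector.
    indicator : Fin n × Fin n → Vector Carrier (size G)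
    indicator e i = when (≡-dec _≟ᶠ_ _≟ᶠ_ (edge G i) e) 1#

    dot-indicator : ∀ j x → dot (indicator (edge G j)) x ≈ x j
    dot-indicator j x = ≈-trans
      (sum-only (λ i → indicator (edge G j) i * x i) j (λ i i≢j → ≈-trans
        (*-congʳ (when-no (≡-dec _≟ᶠ_ _≟ᶠ_ (edge G i) (edge G j)) (i≢j ∘ edge-injective G))) (zeroˡ _)))
      (≈-trans (*-congʳ (when-yes (≡-dec _≟ᶠ_ _≟ᶠ_ (edge G j) (edge G j)) ≡.refl)) (*-identityˡ _))

  -- Joining two graphs by an edge

  module Join {n₁ n₂} (G₁ : Graph n₁) (G₂ : Graph n₂) (u : Fin n₁) (v : Fin n₂) where

    G = joinByEdge G₁ G₂ u v

    left : Fin n₁ → Fin (n₁ ℕ.+ n₂)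
    left = _↑ˡ n₂

    right : Fin n₂ → Fin (n₁ ℕ.+ n₂)
    right = n₁ ↑ʳ_

    Edge : ℕ → Set
    Edge n = Fin n × Fin n

    left² : Edge n₁ → Edge (n₁ ℕ.+ n₂)
    left² (a , b) = left a , left b

    right² : Edge n₂ → Edge (n₁ ℕ.+ n₂)
    right² (a , b) = right a , right b

    bridge : Edge (n₁ ℕ.+ n₂)
    bridge = left u , right v

    left≢right : ∀ {a b} → left a ≢ right b
    left≢right {a} {b} eq = <ᶠ-irrefl eq (↑ˡ<↑ʳ a b)

    δ-left : ∀ a b → δ (left a) (left b) ≈ δ a b
    δ-left a b = when-⇔ (left a ≟ᶠ left b) (a ≟ᶠ b) (↑ˡ-injective n₂ a b) (≡.cong left)

    δ-right : ∀ a b → δ (right a) (right b) ≈ δ a b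
    δ-right a b = when-⇔ (right a ≟ᶠ right b) (a ≟ᶠ b) (↑ʳ-injective n₁ a b) (≡.cong right)

    δ-left-right : ∀ a b → δ (left a) (right b) ≈ 0#
    δ-left-right a b = when-no (left a ≟ᶠ right b) left≢right

    δ-right-left : ∀ a b → δ (right a) (left b) ≈ 0#
    δ-right-left a b = when-no (right a ≟ᶠ left b) (left≢right ∘ ≡.sym)

    inc-left : ∀ x e → inc (left x) (left² e) ≈ inc x e
    inc-left x (a , b) = +-cong (δ-left x a) (δ-left x b)

    inc-right : ∀ x e → inc (right x) (right² e) ≈ inc x e
    inc-right x (a , b) = +-cong (δ-right x a) (δ-right x b)

    inc-left-right : ∀ x e → inc (left x) (right² e) ≈ 0#
    inc-left-right x (a , b) =
      ≈-trans (+-cong (δ-left-right x a) (δ-left-right x b)) (+-identityʳ 0#)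

    inc-right-left : ∀ x e → inc (right x) (left² e) ≈ 0#
    inc-right-left x (a , b) =
      ≈-trans (+-cong (δ-right-left x a) (δ-right-left x b)) (+-identityʳ 0#)

    -- A left row of the incidence matrix of G meets only the edges of G₁ and the bridge. The weight
    -- f lives on pairs so that it makes sense for G and G₁ alike.
    join-left : ∀ x (f : Edge (n₁ ℕ.+ n₂) → Carrier) →
      sum (λ i → inc (left x) (edge G i) * f (edge G i)) ≈
      sum (λ i → inc x (edge G₁ i) * f (left² (edge G₁ i))) + δ x u * f bridge
    join-left x f = ≈-trans
      (join-edge-sum G₁ G₂ u v (λ e → inc (left x) e * f e))
      (+-cong
        (≈-trans
          (+-cong
            (sum-cong-≋ (λ i → *-congʳ (inc-left x (edge G₁ i))))
            (sum-zero (λ i → ≈-trans (*-congʳ (inc-left-right x (edge G₂ i))) (zeroˡ (f (right² (edge G₂ i)))))))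
          (+-identityʳ (sum (λ i → inc x (edge G₁ i) * f (left² (edge G₁ i))))))
        (*-congʳ (≈-trans (+-cong (δ-left x u) (δ-left-right x v)) (+-identityʳ (δ x u)))))

    join-right : ∀ x (f : Edge (n₁ ℕ.+ n₂) → Carrier) →
      sum (λ i → inc (right x) (edge G i) * f (edge G i)) ≈
      sum (λ i → inc x (edge G₂ i) * f (right² (edge G₂ i))) + δ x v * f bridge
    join-right x f = ≈-trans
      (join-edge-sum G₁ G₂ u v (λ e → inc (right x) e * f e))
      (+-cong
        (≈-trans
          (+-cong
            (sum-zero (λ i → ≈-trans (*-congʳ (inc-right-left x (edge G₁ i))) (zeroˡ (f (left² (edge G₁ i))))))
            (sum-cong-≋ (λ i → *-congʳ (inc-right x (edge G₂ i)))))
          (+-identityˡ (sum (λ i → inc x (edge G₂ i) * f (right² (edge G₂ i))))))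
        (*-congʳ (≈-trans (+-cong (δ-right-left x u) (δ-right x v)) (+-identityˡ (δ x v)))))

    -- Every mixed pair receives t; among the mixed pairs only the bridge is listed as an edge, so
    -- the other values are never read.
    glue⊎ : Carrier → (Edge n₁ → Carrier) → (Edge n₂ → Carrier) →
            Fin n₁ ⊎ Fin n₂ → Fin n₁ ⊎ Fin n₂ → Carrier
    glue⊎ t f g (inj₁ a) (inj₁ b) = f (a , b)
    glue⊎ t f g (inj₁ _) (inj₂ _) = t
    glue⊎ t f g (inj₂ _) (inj₁ _) = t
    glue⊎ t f g (inj₂ a) (inj₂ b) = g (a , b)

    glue : Carrier → Vector Carrier (size G₁) → Vector Carrier (size G₂) →
           Edge (n₁ ℕ.+ n₂) → Carrier
    glue t x y (a , b) =
      glue⊎ t (λ e → dot (indicator G₁ e) x) (λ e → dot (indicator G₂ e) y) (splitAt n₁ a) (splitAt n₁ b)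

    glue-left : ∀ t x y i → glue t x y (left² (edge G₁ i)) ≈ x i
    glue-left t x y i = ≈-trans
      (reflexive (≡.cong₂ (glue⊎ t _ _) (splitAt-↑ˡ n₁ _ n₂) (splitAt-↑ˡ n₁ _ n₂)))
      (dot-indicator G₁ i x)

    glue-right : ∀ t x y i → glue t x y (right² (edge G₂ i)) ≈ y i
    glue-right t x y i = ≈-trans
      (reflexive (≡.cong₂ (glue⊎ t _ _) (splitAt-↑ʳ n₁ n₂ _) (splitAt-↑ʳ n₁ n₂ _)))
      (dot-indicator G₂ i y)

    glue-bridge : ∀ t x y → glue t x y bridge ≈ t
    glue-bridge t x y =
      reflexive (≡.cong₂ (glue⊎ t _ _) (splitAt-↑ˡ n₁ u n₂) (splitAt-↑ʳ n₁ n₂ v))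

    glue-cong : ∀ {t t′ x x′ y y′} → t ≈ t′ → x ≈ᵛ x′ → y ≈ᵛ y′ →
                ∀ e → glue t x y e ≈ glue t′ x′ y′ e
    glue-cong t≈ x≈ y≈ (a , b) with splitAt n₁ a | splitAt n₁ b
    ... | inj₁ a′ | inj₁ b′ = dot-cong {x = indicator G₁ (a′ , b′)} (λ _ → ≈-refl) x≈
    ... | inj₁ _  | inj₂ _  = t≈
    ... | inj₂ _  | inj₁ _  = t≈
    ... | inj₂ a′ | inj₂ b′ = dot-cong {x = indicator G₂ (a′ , b′)} (λ _ → ≈-refl) y≈

    glue-linear : ∀ r t t′ x x′ y y′ e →
      glue (r * t + t′) (r * x ⊹ x′) (r * y ⊹ y′) e ≈ r * glue t x y e + glue t′ x′ y′ e
    glue-linear r t t′ x x′ y y′ (a , b) with splitAt n₁ a | splitAt n₁ b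
    ... | inj₁ a′ | inj₁ b′ = dot-linearʳ (indicator G₁ (a′ , b′)) r x x′
    ... | inj₁ _  | inj₂ _  = ≈-refl
    ... | inj₂ _  | inj₁ _  = ≈-refl
    ... | inj₂ a′ | inj₂ b′ = dot-linearʳ (indicator G₂ (a′ , b′)) r y y′

    glue-norm : ∀ t x y → let z = glue t x y ∘ edge G in dot z z ≈ dot x x + dot y y + t * t
    glue-norm t x y = ≈-trans (join-edge-sum G₁ G₂ u v (λ e → glue t x y e * glue t x y e))
      (+-cong (+-cong (sum-cong-≋ (λ i → *-cong (glue-left t x y i) (glue-left t x y i)))
                      (sum-cong-≋ (λ i → *-cong (glue-right t x y i) (glue-right t x y i))))
              (*-cong (glue-bridge t x y) (glue-bridge t x y)))

    glue-incidence-left : ∀ t x y a →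
      apply (incidence G) (glue t x y ∘ edge G) (left a) ≈ apply (incidence G₁) x a + δ a u * t
    glue-incidence-left t x y a = ≈-trans (join-left a (glue t x y))
      (+-cong (sum-cong-≋ (λ i → *-congˡ (glue-left t x y i))) (*-congˡ (glue-bridge t x y)))

    glue-incidence-right : ∀ t x y a →
      apply (incidence G) (glue t x y ∘ edge G) (right a) ≈ apply (incidence G₂) y a + δ a v * t
    glue-incidence-right t x y a = ≈-trans (join-right a (glue t x y))
      (+-cong (sum-cong-≋ (λ i → *-congˡ (glue-right t x y i))) (*-congˡ (glue-bridge t x y)))

    M₁ = adjacency (lineGraph G₁)
    M₂ = adjacency (lineGraph G₂)
    M = adjacency (lineGraph G)

    module _ (W₁ : Inverse (signlessLaplacian G₁ −ᴹ scalar 2#))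
             (W₂ : Inverse (signlessLaplacian G₂ −ᴹ scalar 2#)) where

      private
        module R₁ = Resolvent G₁ W₁ u
        module R₂ = Resolvent G₂ W₂ v

        φ₁ = φ G₁ W₁ u
        φ₂ = φ G₂ W₂ v

      schur : Carrier → Vector Carrier (size G₁) → Vector Carrier (size G₂) → Vector Carrier (size G)
      schur t x y = glue t (R₁.edgePart t x) (R₂.edgePart t y) ∘ edge G

      -- Vertices split into two blocks and edges into two blocks and the bridge. Each side
      -- contributes its own form and -2t²φ by `parts-form`; the bridge's own norm contributes -2t²,
      -- the 1 in the coefficient.
      schur-form : ∀ t x y →
        form M (schur t x y) ≈ form M₁ x + form M₂ y + (- (2# * (1# + (φ₁ + φ₂)))) * (t * t)
      schur-form t x y = begin
        form M z
          ≈⟨ form-lineGraph G z ⟩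
        dot (apply B z) (apply B z) - 2# * dot z z
          ≈⟨ +-cong
               (≈-trans (sum-↑ n₁ (λ i → apply B z i * apply B z i))
                 (+-cong (dot-cong {x = apply B z ∘ left} {x′ = w₁} {y = apply B z ∘ left} {y′ = w₁} at-left at-left)
                         (dot-cong {x = apply B z ∘ right} {x′ = w₂} {y = apply B z ∘ right} {y′ = w₂} at-right at-right)))
               (-‿cong (*-congˡ (glue-norm t e₁ e₂))) ⟩
        dot w₁ w₁ + dot w₂ w₂ - 2# * (dot e₁ e₁ + dot e₂ e₂ + t * t)
          ≈⟨ solve 6 (λ l a b p q s → a :+ b :- l :* (p :+ q :+ s) := (a :- l :* p) :+ (b :- l :* q) :- l :* s)
               ≈-refl 2# (dot w₁ w₁) (dot w₂ w₂) (dot e₁ e₁) (dot e₂ e₂) (t * t) ⟩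
        (dot w₁ w₁ - 2# * dot e₁ e₁) + (dot w₂ w₂ - 2# * dot e₂ e₂) - 2# * (t * t)
          -- The factor `1#` is inserted so that the solver can carry it as a variable into the
          -- coefficient.
          ≈⟨ +-cong (+-cong (R₁.parts-form t x) (R₂.parts-form t y)) (-‿cong (*-congˡ (≈-sym (*-identityˡ _)))) ⟩
        (form M₁ x - 2# * (t * t * φ₁)) + (form M₂ y - 2# * (t * t * φ₂)) - 2# * (1# * (t * t))
          ≈⟨ solve 7 (λ l a b s p q o →
               (a :- l :* (s :* p)) :+ (b :- l :* (s :* q)) :- l :* (o :* s) :=
               a :+ b :+ (:- (l :* (o :+ (p :+ q)))) :* s)
               ≈-refl 2# (form M₁ x) (form M₂ y) (t * t) φ₁ φ₂ 1# ⟩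
        form M₁ x + form M₂ y + (- (2# * (1# + (φ₁ + φ₂)))) * (t * t) ∎
        where
        B = incidence G
        z = schur t x y
        w₁ = R₁.vertexPart t x
        w₂ = R₂.vertexPart t y
        e₁ = R₁.edgePart t x
        e₂ = R₂.edgePart t y

        at-left : apply B z ∘ left ≈ᵛ w₁
        at-left i = ≈-trans (glue-incidence-left t e₁ e₂ i) (R₁.apply-edgePart t x i)

        at-right : apply B z ∘ right ≈ᵛ w₂
        at-right i = ≈-trans (glue-incidence-right t e₁ e₂ i) (R₂.apply-edgePart t y i)

      -- τ reads off the value on the bridge, f and g the two sides; `schur` is linear in the three
      -- jointly.
      schur-map : ∀ {k} → LinearMap k 1 → LinearMap k (size G₁) → LinearMap k (size G₂) →
                  LinearMap k (size G)
      schur-map τ f g = record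
        { map    = λ x → schur (map τ x zero) (map f x) (map g x)
        ; cong   = λ x≈y i → glue-cong (cong τ x≈y zero)
            (λ j → +-cong (*-congʳ (-‿cong (cong τ x≈y zero))) (cong f x≈y j))
            (λ j → +-cong (*-congʳ (-‿cong (cong τ x≈y zero))) (cong g x≈y j)) (edge G i)
        ; linear = λ a x y i → ≈-trans
            (glue-cong (linear τ a x y zero)
              (λ j → shift (linear τ a x y zero) (linear f a x y j))
              (λ j → shift (linear τ a x y zero) (linear g a x y j)) (edge G i))
            (glue-linear a _ _ _ _ _ _ (edge G i))
        }
        where
        shift : ∀ {T F a t t′ p q w} → T ≈ a * t + t′ → F ≈ a * p + q →
                (- T) * w + F ≈ a * ((- t) * w + p) + ((- t′) * w + q)
        shift {a = a} {t} {t′} {p} {q} {w} T≈ F≈ = ≈-trans (+-cong (*-congʳ (-‿cong T≈)) F≈)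
          (solve 6 (λ a t t′ p q w → :- (a :* t :+ t′) :* w :+ (a :* p :+ q) :=
                                     a :* (:- t :* w :+ p) :+ (:- t′ :* w :+ q))
                 ≈-refl a t t′ p q w)

      -- Adding the edge uv perturbs Q(G₁) ⊕ Q(G₂) by a rank-one matrix, so
      -- a 2-eigenvector is determined by the sum s of its entries at u and v.
      join-regular : ¬ (1# + (φ₁ + φ₂) ≈ 0#) →
                     ∀ z → signlessLaplacian G ·ᵛ z ≈ᵛ (λ i → 2# * z i) → Zero z
      join-regular 1+φ≉0 z Qz≈2z = ↑-elim n₂ (λ i → z i ≈ 0#)
        (λ i → ≈-trans (on-left i) (vanish (R₁.g i))) (λ i → ≈-trans (on-right i) (vanish (R₂.g i)))
        where
        s = z (left u) + z (right v)

        gram : ∀ i → sum (λ j → inc i (edge G j) * (z (proj₁ (edge G j)) + z (proj₂ (edge G j)))) ≈ 2# * z i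
        gram i = ≈-trans (sum-cong-≋ (λ j → *-congˡ (≈-sym (applyᵀ-incidence G z j))))
                         (≈-trans (incidence-incidenceᵀ G z i) (Qz≈2z i))

        on-left : ∀ i → z (left i) ≈ - s * R₁.g i
        on-left = R₁.resolve (z ∘ left) s (λ i → ≈-trans
          (+-congʳ (sum-cong-≋ (λ j → *-congˡ (applyᵀ-incidence G₁ (z ∘ left) j))))
          (≈-trans (≈-sym (join-left i (λ (a , b) → z a + z b))) (gram (left i))))

        on-right : ∀ i → z (right i) ≈ - s * R₂.g i
        on-right = R₂.resolve (z ∘ right) s (λ i → ≈-trans
          (+-congʳ (sum-cong-≋ (λ j → *-congˡ (applyᵀ-incidence G₂ (z ∘ right) j))))
          (≈-trans (≈-sym (join-right i (λ (a , b) → z a + z b))) (gram (right i))))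

        -- At u and v themselves the two descriptions give s = -s(φ(u) + φ(v)), that is, (1 + φ(u) +
        -- φ(v))s = 0.
        s≈0 : s ≈ 0#
        s≈0 = *-cancel-≉0 1+φ≉0 (begin
          (1# + (φ₁ + φ₂)) * s            ≈⟨ distribʳ s 1# (φ₁ + φ₂) ⟩
          1# * s + (φ₁ + φ₂) * s          ≈⟨ +-congʳ (*-identityˡ s) ⟩
          s + (φ₁ + φ₂) * s               ≈⟨ +-congʳ (+-cong (on-left u) (on-right v)) ⟩
          - s * φ₁ + - s * φ₂ + (φ₁ + φ₂) * s
            ≈⟨ solve 3 (λ s p q → :- s :* p :+ :- s :* q :+ (p :+ q) :* s := s :- s) ≈-refl s φ₁ φ₂ ⟩
          s - s                           ≈⟨ -‿inverseʳ s ⟩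
          0#                              ∎)

        vanish : ∀ x → - s * x ≈ 0#
        vanish x = ≈-trans (*-congʳ (≈-trans (-‿cong s≈0) -0#≈0#)) (zeroˡ x)

      module _ (-1<φ : - 1# < φ₁ + φ₂) where

        0<1+φ : 0# < 1# + (φ₁ + φ₂)
        0<1+φ = <-respˡ (-‿inverseˡ 1#) (<-respʳ (+-comm (φ₁ + φ₂) 1#) (+-monoˡ-< 1# -1<φ))

        pivot : - (2# * (1# + (φ₁ + φ₂))) < 0#
        pivot = pos-neg (<-respʳ (solve 1 (λ x → x := :- (:- x)) ≈-refl _) (*-pos 0<2 0<1+φ))

        -- The bridge coordinate is set to t = 0, which leaves the orthogonal sum of the two forms.
        join-positive : ∀ {k l} (f : LinearMap k (size G₁)) (g : LinearMap l (size G₂)) →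
          Definite positive M₁ f → Definite positive M₂ g →
          ∃[ h ] Definite positive {k ℕ.+ l} M h
        join-positive {k} {l} f g f-pos g-pos = h , definite
          where
          open Cone positive
          h = schur-map 0ˡ (f ∘ˡ takeˡ l) (g ∘ˡ dropˡ k)

          definite : Definite positive M h
          definite x with add-weak (f-pos (x ∘ (_↑ˡ l))) (λ z → form-zero M₁ (map-zero f z))
                                   (g-pos (x ∘ (k ↑ʳ_))) (λ z → form-zero M₂ (map-zero g z))
          ... | inj₁ (y≈0 , z≈0) = inj₁ (↑-elim l (λ i → x i ≈ 0#) y≈0 z≈0)
          ... | inj₂ 0<form      = inj₂ (<-respʳ (≈-sym (≈-trans (schur-form 0# _ _)
                (≈-trans (+-congˡ (≈-trans (*-congˡ (zeroˡ 0#)) (zeroʳ _))) (+-identityʳ _)))) 0<form)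

        -- The extra dimension is the bridge coordinate t, placed first: it contributes t² times the
        -- negative pivot. This is the source of the -1 in the signature formula.
        join-negative : ∀ {k l} (f : LinearMap k (size G₁)) (g : LinearMap l (size G₂)) →
          Definite negative M₁ f → Definite negative M₂ g →
          ∃[ h ] Definite negative {suc (k ℕ.+ l)} M h
        join-negative {k} {l} f g f-neg g-neg = h , definite
          where
          open Cone negative
          h = schur-map (takeˡ (k ℕ.+ l)) (f ∘ˡ takeˡ l ∘ˡ dropˡ 1) (g ∘ˡ dropˡ k ∘ˡ dropˡ 1)

          definite : Definite negative M h
          definite x with add-weak
            (add-weak (f-neg (x ∘ suc ∘ (_↑ˡ l))) (λ z → form-zero M₁ (map-zero f z))
                      (g-neg (x ∘ suc ∘ (k ↑ʳ_))) (λ z → form-zero M₂ (map-zero g z)))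
            (λ (y≈0 , z≈0) → ≈-trans
              (+-cong (form-zero M₁ (map-zero f y≈0)) (form-zero M₂ (map-zero g z≈0)))
              (+-identityʳ 0#))
            (Sum.map₂ (scale pivot) (zero⊎square-pos (x zero)))
            (λ x₀≈0 → ≈-trans (*-congˡ (≈-trans (*-congʳ x₀≈0) (zeroˡ _))) (zeroʳ _))
          ... | inj₁ ((y≈0 , z≈0) , x₀≈0) = inj₁ λ
                { zero → x₀≈0 ; (suc i) → ↑-elim l (λ i → x (suc i) ≈ 0#) y≈0 z≈0 i }
          ... | inj₂ form<0 = inj₂ (<-respˡ (≈-sym (schur-form (x zero) _ _)) form<0)

-- The bounds give p ≥ p₁ + p₂ and q ≥ q₁ + q₂ + 1. The right-hand sides already add up to p + q, so
-- both are equalities.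
signature-arithmetic : ∀ p₁ q₁ p₂ q₂ p q {m₁ m₂ m} →
  p₁ ℕ.+ q₁ ≡ m₁ → p₂ ℕ.+ q₂ ≡ m₂ → p ℕ.+ q ≡ m → m ≡ suc (m₁ ℕ.+ m₂) →
  (p₁ ℕ.+ p₂) ℕ.+ q ≤ m → p ℕ.+ suc (q₁ ℕ.+ q₂) ≤ m →
  p ⊖ q ≡ (p₁ ⊖ q₁) +ᶻ (p₂ ⊖ q₂) -ᶻ 1ℤ
signature-arithmetic p₁ q₁ p₂ q₂ p q ≡.refl ≡.refl ≡.refl p+q≡ p-bound q-bound = begin
  p ⊖ q                                            ≡⟨ ≡.cong₂ _⊖_ p≡ q≡ ⟩
  (p₁ ℕ.+ p₂) ⊖ suc (q₁ ℕ.+ q₂)                    ≡⟨ ℤₚ.m-n≡m⊖n (p₁ ℕ.+ p₂) (suc (q₁ ℕ.+ q₂)) ⟨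
  (+ p₁ +ᶻ + p₂) -ᶻ (1ℤ +ᶻ (+ q₁ +ᶻ + q₂))
    ≡⟨ ℤ-solve 5 (λ a b c d e → (a ⊕ c) ⊝ (e ⊕ (b ⊕ d)) ⊜ (a ⊝ b) ⊕ (c ⊝ d) ⊝ e)
         ≡.refl (+ p₁) (+ q₁) (+ p₂) (+ q₂) 1ℤ ⟩
  (+ p₁ -ᶻ + q₁) +ᶻ (+ p₂ -ᶻ + q₂) -ᶻ 1ℤ
    ≡⟨ ≡.cong₂ (λ a b → a +ᶻ b -ᶻ 1ℤ) (ℤₚ.m-n≡m⊖n p₁ q₁) (ℤₚ.m-n≡m⊖n p₂ q₂) ⟩
  (p₁ ⊖ q₁) +ᶻ (p₂ ⊖ q₂) -ᶻ 1ℤ                     ∎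
  where
  open ≡.≡-Reasoning
  open CommutativeSemigroupProperties
    (CommutativeMonoid.commutativeSemigroup ℕₚ.+-0-commutativeMonoid) using (interchange)
  open ℤSolver.+-*-Solver using () renaming (solve to ℤ-solve; _:+_ to _⊕_; _:-_ to _⊝_; _:=_ to _⊜_)

  total : p ℕ.+ q ≡ (p₁ ℕ.+ p₂) ℕ.+ suc (q₁ ℕ.+ q₂)
  total = ≡.trans p+q≡ (≡.trans (≡.cong suc (interchange p₁ q₁ p₂ q₂)) (≡.sym (ℕₚ.+-suc _ _)))

  p≥ : p₁ ℕ.+ p₂ ≤ p
  p≥ = ℕₚ.+-cancelʳ-≤ q _ _ p-bound

  q≥ : suc (q₁ ℕ.+ q₂) ≤ q
  q≥ = ℕₚ.+-cancelˡ-≤ p _ _ q-bound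

  p≡ : p ≡ p₁ ℕ.+ p₂
  p≡ = ℕₚ.≤-antisym (ℕₚ.+-cancelʳ-≤ q _ _
    (ℕₚ.≤-trans (ℕₚ.≤-reflexive total) (ℕₚ.+-monoʳ-≤ (p₁ ℕ.+ p₂) q≥))) p≥

  q≡ : q ≡ suc (q₁ ℕ.+ q₂)
  q≡ = ℕₚ.+-cancelˡ-≡ (p₁ ℕ.+ p₂) _ _ (≡.trans (≡.cong (ℕ._+ q) (≡.sym p≡)) total)

lemma4 : ∀ {c ℓ₁ ℓ₂} (F : OrderedField c ℓ₁ ℓ₂) → let open Spectral F in
    ∀ {n₁ n₂} (G₁ : Graph n₁) (G₂ : Graph n₂) →
    n₁ ≤ size G₁ → n₂ ≤ size G₂ →
    ¬ IsEigenvalue (signlessLaplacian G₁) 2# →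
    ¬ IsEigenvalue (signlessLaplacian G₂) 2# →
    (W₁ : Inverse (signlessLaplacian G₁ −ᴹ scalar 2#)) →
    (W₂ : Inverse (signlessLaplacian G₂ −ᴹ scalar 2#)) →
    (u : Fin n₁) (v : Fin n₂) →
    - 1# < φ G₁ W₁ u + φ G₂ W₂ v →
    let G = joinByEdge G₁ G₂ u v in
    ((σ₁ : Spectrum (adjacency (lineGraph G₁))) →
    (σ₂ : Spectrum (adjacency (lineGraph G₂))) →
    (σ : Spectrum (adjacency (lineGraph G))) →
    signature (lineGraph G) σ ≡
    signature (lineGraph G₁) σ₁ +ᶻ signature (lineGraph G₂) σ₂ -ᶻ 1ℤ)
    × ¬ IsEigenvalue (signlessLaplacian G) 2#
lemma4 F G₁ G₂ _ _ _ _ W₁ W₂ u v -1<φ =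
  (λ σ₁ σ₂ σ →
    let f₁ , f₁-pos = positive-map M₁ (lineGraph-symmetric G₁) σ₁
        f₂ , f₂-pos = positive-map M₂ (lineGraph-symmetric G₂) σ₂
        f  , f-pos  = positive-map M (lineGraph-symmetric G) σ
        g₁ , g₁-neg = negative-map M₁ (lineGraph-symmetric G₁) σ₁
        g₂ , g₂-neg = negative-map M₂ (lineGraph-symmetric G₂) σ₂
        g  , g-neg  = negative-map M (lineGraph-symmetric G) σ
        F⁺ , F⁺-pos = join-positive W₁ W₂ -1<φ f₁ f₂ f₁-pos f₂-pos
        G⁻ , G⁻-neg = join-negative W₁ W₂ -1<φ g₁ g₂ g₁-neg g₂-neg
    in signature-arithmetic (#pos σ₁) (#neg σ₁) (#pos σ₂) (#neg σ₂) (#pos σ) (#neg σ)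
         (pos+neg≡ M₁ (lineGraph-symmetric G₁) σ₁ (lineGraph-regular G₁ (Resolvent.regular G₁ W₁ u)))
         (pos+neg≡ M₂ (lineGraph-symmetric G₂) σ₂ (lineGraph-regular G₂ (Resolvent.regular G₂ W₂ v)))
         (pos+neg≡ M (lineGraph-symmetric G) σ (lineGraph-regular G G-regular))
         (size-join G₁ G₂ u v)
         -- Each subspace transported from G₁ and G₂ is set against the eigenvector subspace of G of
         -- the opposite sign, which bounds the indices of G from below.
         (pos+neg≤ M F⁺ g F⁺-pos g-neg)
         (pos+neg≤ M f G⁻ f-pos G⁻-neg)) ,
  λ (z , z≉0 , Qz≈2z) → z≉0 (G-regular z Qz≈2z)
  where
  open LineGraphSignature F
  open Join G₁ G₂ u v
  -- Serves both claims: it makes A(L(G)) nondegenerate, and it excludes the eigenvalue 2 of Q(G).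
  G-regular = join-regular W₁ W₂ (pos⇒≉0 (0<1+φ W₁ W₂ -1<φ))
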